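{- Assume that $\varepsilon\in (0,1/2)$ and let $\mathbb{I}$ be a set of intervals with endpoints in $\{1,\dots, n\}$ that arrive in a data stream. There is a data stream algorithm that uses $O(\varepsilon^{ -5}\log^6 n)$ space and computes a value $\hat\alpha$ such that $$\Pr \Bigl[ \tfrac{1}{2}(1-\varepsilon)\cdot \alpha(\mathbb{I}) \le \hat\alpha \le \alpha(\mathbb{I}) \Bigr] \ge \frac 23.$$
   Context: Input intervals are closed intervals. A set of intervals is independent if its members are pairwise disjoint; $\alpha(\mathbb{I})$ denotes the largest cardinality of an independent subset of $\mathbb{I}$. In the data stream model the intervals arrive one at a time, in arbitrary order, and the algorithm makes a single pass: past input cannot be accessed unless it was stored in memory. One unit of memory can store a value in $\{1,\dots,n\}$; space is counted in such units. The algorithm is randomized (it knows $n$ and $\varepsilon$) and the probability is over its internal randomness, for every fixed input stream. -}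

module Defs where

open import Data.Empty using (⊥-elim)
open import Data.Empty.Irrelevant using () renaming (⊥-elim to ⊥-elim-irr)
open import Data.Fin.Base as Fin using (Fin; toℕ)
import Data.Fin.Properties as Fin
import Data.Integer.Base as ℤ
import Data.Integer.Properties as ℤ
open import Data.List.Base using (List; []; _∷_; _++_; map; filter; length)
open import Data.List.Extrema.Nat using (max)
open import Data.List.Relation.Unary.All using (All)
open import Data.List.Relation.Unary.AllPairs using (AllPairs; allPairs?)
open import Data.List.Relation.Unary.Unique.Propositional using (Unique)
open import Data.Nat.Base as ℕ using (ℕ; suc)
open import Data.Nat.Logarithm using (⌊log₂_⌋)
import Data.Nat.Properties as ℕ
open import Data.Product.Base using (_×_; _,_; ∃; ∃-syntax)
open import Data.Rational.Base
open import Data.Rational.Properties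
import Data.Rational.Unnormalised.Base as ℚᵘ
import Data.Rational.Unnormalised.Properties as ℚᵘ
open import Data.Sum.Base using (_⊎_; inj₁; inj₂)
open import Data.Vec.Base using (Vec; []; _∷_)
open import Relation.Binary.Definitions using (Decidable; tri<; tri≈; tri>)
open import Relation.Binary.PropositionalEquality using (_≡_; refl; subst; subst₂; sym)
open import Relation.Nullary using (¬_; Dec; yes; no; _⊎-dec_)
open import Relation.Nullary.Decidable using (map′)

fromℕ : ℕ → ℚ
fromℕ m = ℤ.+ m / 1

-- Real numbers as located Dedekind cuts: q <ˡ x is "q < x", x <ʳ q is "x < q".

record ℝ : Set₁ where
  field
    lower           : ℚ → Set
    upper           : ℚ → Set
    lower-inhabited : ∃ lower
    upper-inhabited : ∃ upper
    lower-closed    : ∀ {p q} → p < q → lower q → lower p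
    upper-closed    : ∀ {p q} → p < q → upper p → upper q
    lower-open      : ∀ {p} → lower p → ∃[ q ] p < q × lower q
    upper-open      : ∀ {q} → upper q → ∃[ p ] p < q × upper p
    disjoint        : ∀ {q} → lower q → ¬ upper q
    located         : ∀ {p q} → p < q → lower p ⊎ upper q

infix 4 _<ˡ_ _<ʳ_

_<ˡ_ : ℚ → ℝ → Set
q <ˡ x = ℝ.lower x q

_<ʳ_ : ℝ → ℚ → Set
x <ʳ q = ℝ.upper x q

private
  q-1<q : ∀ q → q - 1ℚ < q
  q-1<q q = subst (q - 1ℚ <_) (+-identityʳ q)
              (+-monoʳ-< q { - 1ℚ} {0ℚ} (*<* ℤ.-<+))

  q<q+1 : ∀ q → q < q + 1ℚ
  q<q+1 q = subst (_< q + 1ℚ) (+-identityʳ q)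
              (+-monoʳ-< q {0ℚ} {1ℚ} (*<* (ℤ.+<+ (ℕ.s≤s ℕ.z≤n))))

fromℚ : ℚ → ℝ
fromℚ r = record
  { lower           = _< r
  ; upper           = r <_
  ; lower-inhabited = r - 1ℚ , q-1<q r
  ; upper-inhabited = r + 1ℚ , q<q+1 r
  ; lower-closed    = <-trans
  ; upper-closed    = λ p<q r<p → <-trans r<p p<q
  ; lower-open      = λ p<r → let m , p<m , m<r = <-dense p<r in m , p<m , m<r
  ; upper-open      = λ r<q → let m , r<m , m<q = <-dense r<q in m , m<q , r<m
  ; disjoint        = <-asym
  ; located         = located
  }
  where
  located : ∀ {p q} → p < q → p < r ⊎ r < q
  located {p} p<q with p <? r
  ... | yes p<r = inj₁ p<r
  ... | no  p≮r = inj₂ (≤-<-trans (≮⇒≥ p≮r) p<q)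

-- Fin n stands for {1,…,n}: the element i represents the number 1 + toℕ i.

record Interval (n : ℕ) : Set where
  constructor interval
  field
    left right  : Fin n
    .left≤right : left Fin.≤ right

open Interval public

coordinate : ∀ {n} → Fin n → ℚ
coordinate i = fromℕ (suc (toℕ i))

infix 4 _∈ᴵ_

_∈ᴵ_ : ∀ {n} → ℝ → Interval n → Set
x ∈ᴵ I = ¬ (x <ʳ coordinate (left I)) × ¬ (coordinate (right I) <ˡ x)

Disjoint : ∀ {n} → Interval n → Interval n → Set₁
Disjoint I J = ∀ (x : ℝ) → ¬ (x ∈ᴵ I × x ∈ᴵ J)

coordinate-mono-< : ∀ {n} {i j : Fin n} → i Fin.< j → coordinate i < coordinate j
coordinate-mono-< {i = i} {j} i<j = toℚᵘ-cancel-<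
  (ℚᵘ-resp (suc (toℕ i)) (suc (toℕ j)) (ℕ.s≤s i<j))
  where
  ℚᵘ-resp : ∀ a b → a ℕ.< b → toℚᵘ (fromℕ a) ℚᵘ.< toℚᵘ (fromℕ b)
  ℚᵘ-resp a b a<b =
    ℚᵘ.<-respˡ-≃ (ℚᵘ.≃-sym (toℚᵘ-fromℚᵘ (ℚᵘ.mkℚᵘ (ℤ.+ a) 0)))
      (ℚᵘ.<-respʳ-≃ (ℚᵘ.≃-sym (toℚᵘ-fromℚᵘ (ℚᵘ.mkℚᵘ (ℤ.+ b) 0)))
        (ℚᵘ.*<* (subst₂ ℤ._<_ (sym (ℤ.*-identityʳ (ℤ.+ a)))
                              (sym (ℤ.*-identityʳ (ℤ.+ b)))
                              (ℤ.+<+ a<b))))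

coordinate-reflects-< : ∀ {n} {i j : Fin n} → coordinate i < coordinate j → i Fin.< j
coordinate-reflects-< {i = i} {j} p with ℕ.<-cmp (toℕ i) (toℕ j)
... | tri< i<j _ _ = i<j
... | tri≈ _ i≡j _ =
      ⊥-elim (<-irrefl refl (subst (λ k → coordinate i < fromℕ (suc k)) (sym i≡j) p))
... | tri> _ _ j<i = ⊥-elim (<-asym p (coordinate-mono-< j<i))

apart⇒disjoint : ∀ {n} (I J : Interval n) → right I Fin.< left J → Disjoint I J
apart⇒disjoint I J r<l x ((_ , ¬r<x) , (¬x<l , _))
  with ℝ.located x (coordinate-mono-< r<l)
... | inj₁ r<x = ¬r<x r<x
... | inj₂ x<l = ¬x<l x<l

-- If neither interval lies to the left of the other, the larger of the
-- two left endpoints is a common point.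
disjoint⇒apart : ∀ {n} (I J : Interval n) → Disjoint I J →
                 ¬ right I Fin.< left J → right J Fin.< left I
disjoint⇒apart I@(interval lI rI lI≤rI) J@(interval lJ rJ lJ≤rJ) dis rI≮lJ
  with toℕ rJ ℕ.<? toℕ lI | toℕ lI ℕ.≤? toℕ lJ | toℕ rJ ℕ.<? toℕ lJ | toℕ rI ℕ.<? toℕ lI
... | yes rJ<lI | _ | _ | _ = rJ<lI
... | no _ | _ | yes rJ<lJ | _ = ⊥-elim-irr (ℕ.<⇒≱ rJ<lJ lJ≤rJ)
... | no _ | _ | no _ | yes rI<lI = ⊥-elim-irr (ℕ.<⇒≱ rI<lI lI≤rI)
... | no _ | yes lI≤lJ | no rJ≮lJ | no _ = ⊥-elim (dis (fromℚ (coordinate lJ))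
      ( ( (λ p → ℕ.<⇒≱ (coordinate-reflects-< {i = lJ} {lI} p) lI≤lJ)
        , (λ p → rI≮lJ (coordinate-reflects-< {i = rI} {lJ} p)))
      , ( <-irrefl refl
        , (λ p → rJ≮lJ (coordinate-reflects-< {i = rJ} {lJ} p)))))
... | no rJ≮lI | no lI≰lJ | no _ | no rI≮lI = ⊥-elim (dis (fromℚ (coordinate lI))
      ( ( <-irrefl refl
        , (λ p → rI≮lI (coordinate-reflects-< {i = rI} {lI} p)))
      , ( (λ p → lI≰lJ (ℕ.<⇒≤ (coordinate-reflects-< {i = lI} {lJ} p)))
        , (λ p → rJ≮lI (coordinate-reflects-< {i = rJ} {lI} p)))))

disjoint? : ∀ {n} → Decidable (Disjoint {n})
disjoint? I J = map′ to from ((right I Fin.<? left J) ⊎-dec (right J Fin.<? left I))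
  where
  to : right I Fin.< left J ⊎ right J Fin.< left I → Disjoint I J
  to (inj₁ p) = apart⇒disjoint I J p
  to (inj₂ p) = λ x (x∈I , x∈J) → apart⇒disjoint J I p x (x∈J , x∈I)
  from : Disjoint I J → right I Fin.< left J ⊎ right J Fin.< left I
  from dis with toℕ (right I) ℕ.<? toℕ (left J)
  ... | yes p = inj₁ p
  ... | no ¬p = inj₂ (disjoint⇒apart I J dis ¬p)

Independent : ∀ {n} → List (Interval n) → Set₁
Independent = AllPairs Disjoint

independent? : ∀ {n} (S : List (Interval n)) → Dec (Independent S)
independent? = allPairs? disjoint?

sublists : ∀ {A : Set} → List A → List (List A)
sublists []       = [] ∷ []
sublists (x ∷ xs) = sublists xs ++ map (x ∷_) (sublists xs)

-- For a duplicate-free list, its sublists are exactly the subsets of the set it enumerates.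
α : ∀ {n} → List (Interval n) → ℕ
α 𝕀 = max 0 (map length (filter independent? (sublists 𝕀)))

-- A one-pass randomized algorithm using s units of memory, each holding a
-- value in {1,…,n}.  Every stage draws a fresh, independent and uniformly
-- distributed element of Fin coins.  Nothing but the memory is passed from
-- one stage to the next, so the algorithm has to pay for every past interval
-- and every past random choice it wants to remember.

record StreamingAlgorithm (n s : ℕ) : Set where
  Memory : Set
  Memory = Vec (Fin n) s
  field
    coins        : ℕ
    .{{coins≢0}} : ℕ.NonZero coins
    start        : Fin coins → Memory
    process      : Fin coins → Interval n → Memory → Memory
    output       : Fin coins → Memory → ℚ

module _ {n s} (A : StreamingAlgorithm n s) where
  open StreamingAlgorithm A

  draws : List (Interval n) → ℕ
  draws 𝕀 = 2 ℕ.+ length 𝕀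

  resume : (𝕀 : List (Interval n)) → Vec (Fin coins) (1 ℕ.+ length 𝕀) → Memory → ℚ
  resume []      (c ∷ []) μ = output c μ
  resume (I ∷ 𝕀) (c ∷ cs) μ = resume 𝕀 cs (process c I μ)

  run : (𝕀 : List (Interval n)) → Vec (Fin coins) (draws 𝕀) → ℚ
  run 𝕀 (c ∷ cs) = resume 𝕀 cs (start c)

-- Pr[ E ]≥ p: under the uniform distribution on Vec (Fin c) k, a space of
-- c ^ k outcomes, the event E has probability at least p.  Since E need not be
-- decidable (it may involve a real number), its favourable outcomes are listed.

Pr[_]≥_ : ∀ {c k} → (Vec (Fin c) k → Set) → ℚ → Set
Pr[_]≥_ {c} {k} E p = ∃[ ωs ] Unique ωs × All E ωs × p * fromℕ (c ℕ.^ k) ≤ fromℕ (length ωs)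

-- ½ (1 - ε) a ≤ v ≤ a.  The real inequality on the left is expressed through the
-- rationals above ε: the left-hand side is continuous and nonincreasing in ε.
Approximates : ℝ → ℕ → ℚ → Set
Approximates ε a v = (∀ q → ε <ʳ q → ½ * (1ℚ - q) * fromℕ a ≤ v) × v ≤ fromℕ a

-- s ≤ C ε⁻⁵ log⁶ n, that is, ε⁵ s ≤ C log⁶ n, expressed through the positive
-- rationals below ε.  For n ≥ 2 the rounded binary logarithm is within
-- a constant factor of the logarithm to any fixed base.
SpaceBound : ℕ → ℕ → ℝ → ℕ → Set
SpaceBound C n ε s = ∀ q → 0ℚ < q → q <ˡ ε →
  (q * q * q * q * q) * fromℕ s ≤ fromℕ (C ℕ.* ⌊log₂ n ⌋ ℕ.^ 6)

{-# OPTIONS --safe #-}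
module Submission where

-- Let 𝕀|u be the intervals inside the dyadic block u.  The windows of u are the
-- [x , y] that share an end with some block v ⊆ u and contain an interval of
-- 𝕀|v, while staying inside v; gain u is the largest number of disjoint ones.
-- Replacing windows by intervals they contain gives gain ≤ α; conversely the
-- hull of two consecutive intervals of an independent set contains a window (at
-- the dyadic cut between them), whence α ≤ 2 gain.
--
-- Windows only depend on the least right end and the greatest left end of each
-- 𝕀|v, and gain u exceeds the sum over the two halves of u by jump u ∈ {0 , 1}.
-- So gain at the root is the number of blocks u with jump u = 1, which is
-- estimated from a pairwise independent sample of the blocks, at all rates 2⁻ʲ
-- in parallel.  The ends are stored for every block below a sampled one, and a
-- level is abandoned when its table overflows.  There are at most (1 + h) gain
-- nonempty blocks, each with at most 1 + h ancestors, so Markov's inequality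
-- bounds the tables and Chebyshev's inequality the error of the first level
-- that survives.

open import Defs
open import Data.Bool.Base using (Bool; true; false; not; _∧_; _∨_; _xor_; if_then_else_)
open import Data.Empty using (⊥; ⊥-elim)
open import Data.Fin.Base as Fin using (Fin; toℕ)
import Data.Fin.Properties as Fin
open import Data.Integer.Base as ℤ using (+_)
import Data.Integer.Properties as ℤ
open import Data.List.Base
  using (List; []; _∷_; _++_; _ʳ++_; allFin; cartesianProductWith; filter; length; lookup; map; reverse)
open import Data.List.Extrema.Nat using (argmax-sel; xs≤max)
open import Data.List.Membership.Propositional using (_∈_)
open import Data.List.Membership.Propositional.Properties
  using (∈-++⁺ˡ; ∈-++⁺ʳ; ∈-++⁻; ∈-map⁺; ∈-map⁻; ∈-filter⁺; ∈-filter⁻; ∈-∃++)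
open import Data.List.Properties
  using (length-++; length-map; length-tabulate; map-tabulate; tabulate-lookup)
open import Data.List.Relation.Unary.All as All using (All; []; _∷_)
import Data.List.Relation.Unary.All.Properties as All
open import Data.List.Relation.Unary.AllPairs as AllPairs using (AllPairs; []; _∷_)
open import Data.List.Relation.Unary.Any using (here; there)
import Data.List.Relation.Unary.Any.Properties as Any
open import Data.List.Relation.Unary.Unique.Propositional using (Unique)
import Data.List.Relation.Unary.Unique.Propositional.Properties as Unique
open import Data.Maybe.Base using (Maybe; just; nothing; is-just)
open import Data.Nat.Base
  using (ℕ; zero; suc; _+_; _*_; _^_; _∸_; _≤_; _<_; z≤n; s≤s; ∣_-_∣; NonZero; >-nonZero)
open import Data.Nat.Logarithm using (⌊log₂_⌋; ⌊log₂⌋-mono-≤; ⌊log₂[2^n]⌋≡n)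
open import Data.Nat.Properties
open import Data.Nat.Tactic.RingSolver using (solve-∀)
open import Data.Product.Base using (_×_; _,_; ∃-syntax; Σ-syntax; proj₁; proj₂)
open import Data.Rational.Base as ℚ using (ℚ; mkℚ; 0ℚ; 1ℚ; ½; _/_)
import Data.Rational.Properties as ℚ
open import Data.Rational.Solver using () renaming (module +-*-Solver to ℚ-Solver)
open import Data.Rational.Unnormalised.Base as ℚᵘ using (mkℚᵘ; *≡*; *≤*)
import Data.Rational.Unnormalised.Properties as ℚᵘ
open import Data.Sum.Base using (_⊎_; inj₁; inj₂)
open import Data.Vec.Base as Vec using (Vec; []; _∷_)
import Data.Vec.Properties as Vec
open import Function.Base using (_∘_; case_of_; id)
open import Relation.Binary.Definitions using (Decidable; DecidableEquality)
open import Relation.Binary.PropositionalEquality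
  using (_≡_; _≢_; refl; sym; trans; cong; cong₂; subst; module ≡-Reasoning)
open import Relation.Nullary using (Dec; yes; no; does; ¬_; _×-dec_; _⊎-dec_)
open import Relation.Nullary.Decidable using (recompute)

-- An optimum cannot be sampled, but a count can. `gain` becomes a count because a block exceeds its
-- halves by at most one: only one window of a chain can cross the midpoint, and any other window of
-- the block is a window of a half. That is the reason to stretch intervals to windows sharing an
-- end with a block; it also makes a summary of two numbers sufficient.
--
-- The first level that survives depends on the seed, so the variance at one fixed level does not
-- control the error. The analysis therefore fixes a level `j` from `gain` alone: high enough that
-- its table is small on average, low enough that all levels up to `j` are accurate simultaneously.
-- If the table of level `j` fits, the level that is read is one of these. Overflow costs
-- probability 1/12 and inaccuracy 1/4, which leaves 2/3.
--
-- The output must never exceed α when the estimate is good, so an estimate with relative error 1/E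
-- is scaled by E/(1 + E).
--
-- With 1 + h levels, O(h² ε⁻²) entries per table and O(h) units per entry, the sketch takes O(ε⁻²
-- log⁴ n) units, which lies within the claimed bound.

-- Finite sums

module _ {A : Set} where

  ∑ : List A → (A → ℕ) → ℕ
  ∑ []       f = 0
  ∑ (x ∷ xs) f = f x + ∑ xs f

  ∑-cong : ∀ xs {f g : A → ℕ} → (∀ x → f x ≡ g x) → ∑ xs f ≡ ∑ xs g
  ∑-cong []       f≡g = refl
  ∑-cong (x ∷ xs) f≡g = cong₂ _+_ (f≡g x) (∑-cong xs f≡g)

  ∑-mono : ∀ xs {f g : A → ℕ} → (∀ x → f x ≤ g x) → ∑ xs f ≤ ∑ xs g
  ∑-mono []       f≤g = z≤n
  ∑-mono (x ∷ xs) f≤g = +-mono-≤ (f≤g x) (∑-mono xs f≤g)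

  ∑-+ : ∀ xs (f g : A → ℕ) → ∑ xs (λ x → f x + g x) ≡ ∑ xs f + ∑ xs g
  ∑-+ []       f g = refl
  ∑-+ (x ∷ xs) f g rewrite ∑-+ xs f g = interchange (f x) (g x) (∑ xs f) (∑ xs g)
    where
    interchange : ∀ a b c d → a + b + (c + d) ≡ a + c + (b + d)
    interchange = solve-∀

  ∑-*ˡ : ∀ c xs (f : A → ℕ) → ∑ xs (λ x → c * f x) ≡ c * ∑ xs f
  ∑-*ˡ c []       f = sym (*-zeroʳ c)
  ∑-*ˡ c (x ∷ xs) f rewrite ∑-*ˡ c xs f = sym (*-distribˡ-+ c (f x) (∑ xs f))

  ∑-*ʳ : ∀ xs (f : A → ℕ) c → ∑ xs (λ x → f x * c) ≡ ∑ xs f * c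
  ∑-*ʳ xs f c = trans (∑-cong xs (λ x → *-comm (f x) c))
                  (trans (∑-*ˡ c xs f) (*-comm c (∑ xs f)))

  ∑-const : ∀ xs c → ∑ xs (λ _ → c) ≡ length xs * c
  ∑-const []       c = refl
  ∑-const (x ∷ xs) c = cong (_+_ c) (∑-const xs c)

  ∑-++ : ∀ xs ys (f : A → ℕ) → ∑ (xs ++ ys) f ≡ ∑ xs f + ∑ ys f
  ∑-++ []       ys f = refl
  ∑-++ (x ∷ xs) ys f rewrite ∑-++ xs ys f = sym (+-assoc (f x) (∑ xs f) (∑ ys f))

module _ {A B : Set} where

  ∑-map : ∀ (h : A → B) xs f → ∑ (map h xs) f ≡ ∑ xs (f ∘ h)
  ∑-map h []       f = refl
  ∑-map h (x ∷ xs) f = cong (_+_ (f (h x))) (∑-map h xs f)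

  ∑-swap : ∀ (xs : List A) (ys : List B) (f : A → B → ℕ) →
           ∑ xs (λ x → ∑ ys (f x)) ≡ ∑ ys (λ y → ∑ xs (λ x → f x y))
  ∑-swap []       ys f = sym (trans (∑-const ys 0) (*-zeroʳ (length ys)))
  ∑-swap (x ∷ xs) ys f rewrite ∑-swap xs ys f = sym (∑-+ ys (f x) _)

  ∑-*-∑ : ∀ (xs : List A) (ys : List B) (f : A → ℕ) (g : B → ℕ) →
          ∑ xs f * ∑ ys g ≡ ∑ xs (λ x → ∑ ys (λ y → f x * g y))
  ∑-*-∑ xs ys f g = trans (sym (∑-*ʳ xs f (∑ ys g)))
                      (∑-cong xs (λ x → sym (∑-*ˡ (f x) ys g)))

∑-cartesianProductWith :
  ∀ {A B C : Set} (_∙_ : A → B → C) xs ys f →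
  ∑ (cartesianProductWith _∙_ xs ys) f ≡ ∑ xs (λ x → ∑ ys (λ y → f (x ∙ y)))
∑-cartesianProductWith _∙_ []       ys f = refl
∑-cartesianProductWith _∙_ (x ∷ xs) ys f =
  trans (∑-++ (map (x ∙_) ys) _ f)
    (cong₂ _+_ (∑-map (x ∙_) ys f) (∑-cartesianProductWith _∙_ xs ys f))

vectors : ∀ {A : Set} → List A → ∀ k → List (Vec A k)
vectors xs zero    = [] ∷ []
vectors xs (suc k) = cartesianProductWith _∷_ xs (vectors xs k)

-- Linear hashing over GF(2)

⟦_⟧ : Bool → ℕ
⟦ true  ⟧ = 1
⟦ false ⟧ = 0

⟦∧⟧ : ∀ a b → ⟦ a ∧ b ⟧ ≡ ⟦ a ⟧ * ⟦ b ⟧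
⟦∧⟧ true  b = sym (*-identityˡ ⟦ b ⟧)
⟦∧⟧ false b = refl

⟦⟧≤1 : ∀ b → ⟦ b ⟧ ≤ 1
⟦⟧≤1 true  = ≤-refl
⟦⟧≤1 false = z≤n

⟦⟧-idem : ∀ b → ⟦ b ⟧ * ⟦ b ⟧ ≡ ⟦ b ⟧
⟦⟧-idem true  = refl
⟦⟧-idem false = refl

bits : List Bool
bits = false ∷ true ∷ []

dot : ∀ {w} → Vec Bool w → Vec Bool w → Bool
dot []      []      = false
dot (r ∷ rs) (x ∷ xs) = (r ∧ x) xor dot rs xs

Row : ℕ → Set
Row w = Vec Bool (suc w)

-- A random affine functional. Its constant bit makes the value uniform at every point, the zero
-- vector included, and jointly uniform at two distinct points.
hit : ∀ {w} → Row w → Vec Bool w → Bool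
hit (b ∷ r) x = b xor dot r x

rows : ∀ w → List (Row w)
rows w = vectors bits (suc w)

length-cartesianProductWith :
  ∀ {A B C : Set} (_∙_ : A → B → C) xs ys →
  length (cartesianProductWith _∙_ xs ys) ≡ length xs * length ys
length-cartesianProductWith _∙_ []       ys = refl
length-cartesianProductWith _∙_ (x ∷ xs) ys = trans (length-++ (map (x ∙_) ys))
  (cong₂ _+_ (length-map (x ∙_) ys) (length-cartesianProductWith _∙_ xs ys))

length-vectors : ∀ {A : Set} (xs : List A) k → length (vectors xs k) ≡ length xs ^ k
length-vectors xs zero    = refl
length-vectors xs (suc k) = trans (length-cartesianProductWith _∷_ xs (vectors xs k))
  (cong (length xs *_) (length-vectors xs k))

private
  bit-sum : ∀ (f : Bool → ℕ) → ∑ bits f ≡ f false + f true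
  bit-sum f = cong (_+_ (f false)) (+-identityʳ (f true))

∑-Bool : ∀ w (f : Vec Bool (suc w) → ℕ) →
         ∑ (vectors bits (suc w)) f ≡ ∑ (vectors bits w) (λ r → f (false ∷ r) + f (true ∷ r))
∑-Bool w f = trans (∑-cartesianProductWith _∷_ bits (vectors bits w) f)
  (trans (bit-sum (λ b → ∑ (vectors bits w) (λ r → f (b ∷ r))))
    (sym (∑-+ (vectors bits w) (f ∘ (false ∷_)) (f ∘ (true ∷_)))))

∑-one : ∀ w → ∑ (vectors bits w) (λ _ → 1) ≡ 2 ^ w
∑-one w = trans (∑-const (vectors bits w) 1)
            (trans (*-identityʳ _) (length-vectors bits w))

∑-hit : ∀ {w} (x : Vec Bool w) → ∑ (rows w) (λ r → ⟦ hit r x ⟧) ≡ 2 ^ w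
∑-hit {w} x = trans (∑-Bool w _)
  (trans (∑-cong (vectors bits w) (λ r → lemma (dot r x))) (∑-one w))
  where
  lemma : ∀ b → ⟦ b ⟧ + ⟦ not b ⟧ ≡ 1
  lemma true  = refl
  lemma false = refl

agree : Bool → Bool → ℕ
agree a b = ⟦ not (a xor b) ⟧

-- The recursion runs to the first coordinate where `x` and `y` differ; there exactly one of the two
-- values of the bit of `r` makes the products agree. At an equal coordinate that bit flips both
-- products or neither.
∑-agree : ∀ {w} (x y : Vec Bool w) → x ≢ y →
          2 * ∑ (vectors bits w) (λ r → agree (dot r x) (dot r y)) ≡ 2 ^ w
∑-agree {zero}  []      []      x≢y = ⊥-elim (x≢y refl)
∑-agree {suc w} (a ∷ x) (b ∷ y) x≢y = trans (cong (2 *_) (∑-Bool w _)) (go a b x≢y)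
  where
  S : List (Vec Bool w)
  S = vectors bits w
  same : ∀ s t → agree s t + agree (not s) (not t) ≡ 2 * agree s t
  same true  true  = refl
  same true  false = refl
  same false true  = refl
  same false false = refl
  diff : ∀ s t → agree s t + agree (not s) t ≡ 1
  diff true  true  = refl
  diff true  false = refl
  diff false true  = refl
  diff false false = refl
  diff′ : ∀ s t → agree s t + agree s (not t) ≡ 1
  diff′ true  true  = refl
  diff′ true  false = refl
  diff′ false true  = refl
  diff′ false false = refl
  go : ∀ a b → a ∷ x ≢ b ∷ y →
       2 * ∑ S (λ r → agree (dot r x) (dot r y) +
                      agree (a xor dot r x) (b xor dot r y)) ≡ 2 ^ suc w
  go true  true  ne = cong (2 *_) (trans (∑-cong S (λ r → same (dot r x) (dot r y)))
    (trans (∑-*ˡ 2 S _) (∑-agree x y (λ x≡y → ne (cong (true ∷_) x≡y)))))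
  go false false ne = cong (2 *_) (trans (∑-cong S (λ r → double (agree (dot r x) (dot r y))))
    (trans (∑-*ˡ 2 S _) (∑-agree x y (λ x≡y → ne (cong (false ∷_) x≡y)))))
    where
    double : ∀ k → k + k ≡ 2 * k
    double = solve-∀
  go true  false ne = cong (2 *_) (trans (∑-cong S (λ r → diff (dot r x) (dot r y))) (∑-one w))
  go false true  ne = cong (2 *_) (trans (∑-cong S (λ r → diff′ (dot r x) (dot r y))) (∑-one w))

-- Toggling the constant bit flips both hits, so one of its two values hits both points if the
-- linear parts agree, and none does otherwise.
∑-hit-hit : ∀ {w} (x y : Vec Bool w) → x ≢ y →
            2 * ∑ (rows w) (λ r → ⟦ hit r x ⟧ * ⟦ hit r y ⟧) ≡ 2 ^ w
∑-hit-hit {w} x y x≢y = trans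
  (cong (2 *_) (trans (∑-Bool w _) (∑-cong (vectors bits w) (λ r → lemma (dot r x) (dot r y)))))
  (∑-agree x y x≢y)
  where
  lemma : ∀ s t → ⟦ s ⟧ * ⟦ t ⟧ + ⟦ not s ⟧ * ⟦ not t ⟧ ≡ agree s t
  lemma true  true  = refl
  lemma true  false = refl
  lemma false true  = refl
  lemma false false = refl

Seed : ℕ → ℕ → Set
Seed w m = Vec (Row w) m

seeds : ∀ w m → List (Seed w m)
seeds w m = vectors (rows w) m

-- Being hit by the first `j` rows has probability 2⁻ʲ, so one seed serves all levels. The clause
-- for an exhausted seed is a default; the counting lemmas assume `j ≤ m`.
sampled : ∀ {w m} → ℕ → Seed w m → Vec Bool w → Bool
sampled zero    s       x = true
sampled (suc j) []      x = true
sampled (suc j) (r ∷ s) x = hit r x ∧ sampled j s x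

module _ {w : ℕ} (f : Row w → ℕ) where

  weight : ∀ {m} → ℕ → Seed w m → ℕ
  weight zero    s       = 1
  weight (suc j) []      = 1
  weight (suc j) (r ∷ s) = f r * weight j s

  -- The rows of a seed are independent, so the sum factorises; `c` is the reciprocal of the mean of
  -- `f`, and the rows after the first `j` are free.
  ∑-weight : ∀ c → c * ∑ (rows w) f ≡ length (rows w) → ∀ {j m} → j ≤ m →
             c ^ j * ∑ (seeds w m) (weight j) ≡ length (seeds w m)
  ∑-weight c c∑≡ {m = m} z≤n = trans (+-identityʳ _)
    (trans (∑-const (seeds w m) 1) (*-identityʳ _))
  ∑-weight c c∑≡ {suc j} {suc m} (s≤s j≤m) = begin
    c ^ suc j * ∑ (seeds w (suc m)) (weight (suc j))
      ≡⟨ cong (c ^ suc j *_) (trans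
           (∑-cartesianProductWith _∷_ (rows w) (seeds w m) (weight (suc j)))
           (sym (∑-*-∑ (rows w) (seeds w m) f (weight j)))) ⟩
    c * c ^ j * (∑ (rows w) f * ∑ (seeds w m) (weight j))
      ≡⟨ regroup c (c ^ j) (∑ (rows w) f) (∑ (seeds w m) (weight j)) ⟩
    c * ∑ (rows w) f * (c ^ j * ∑ (seeds w m) (weight j))
      ≡⟨ cong₂ _*_ c∑≡ (∑-weight c c∑≡ j≤m) ⟩
    length (rows w) * length (seeds w m)
      ≡⟨ cong (length (rows w) *_) (length-vectors (rows w) m) ⟩
    length (rows w) ^ suc m
      ≡⟨ sym (length-vectors (rows w) (suc m)) ⟩
    length (seeds w (suc m)) ∎
    where
    open ≡-Reasoning
    regroup : ∀ a b c d → a * b * (c * d) ≡ a * c * (b * d)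
    regroup = solve-∀

weight-* : ∀ {w} (f g : Row w → ℕ) {m} j (s : Seed w m) →
           weight (λ r → f r * g r) j s ≡ weight f j s * weight g j s
weight-* f g zero    s       = refl
weight-* f g (suc j) []      = refl
weight-* f g (suc j) (r ∷ s) rewrite weight-* f g j s =
  interchange (f r) (g r) (weight f j s) (weight g j s)
  where
  interchange : ∀ a b c d → a * b * (c * d) ≡ a * c * (b * d)
  interchange = solve-∀

sampled≡weight : ∀ {w m} j (s : Seed w m) x → ⟦ sampled j s x ⟧ ≡ weight (λ r → ⟦ hit r x ⟧) j s
sampled≡weight zero    s       x = refl
sampled≡weight (suc j) []      x = refl
sampled≡weight (suc j) (r ∷ s) x =
  trans (⟦∧⟧ (hit r x) _) (cong (⟦ hit r x ⟧ *_) (sampled≡weight j s x))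

∑-sampled : ∀ {w j m} (x : Vec Bool w) → j ≤ m →
            2 ^ j * ∑ (seeds w m) (λ s → ⟦ sampled j s x ⟧) ≡ length (seeds w m)
∑-sampled {w} {j} {m} x j≤m =
  trans (cong (2 ^ j *_) (∑-cong (seeds w m) (λ s → sampled≡weight j s x)))
    (∑-weight _ 2 (trans (cong (2 *_) (∑-hit x)) (sym (length-vectors bits (suc w)))) j≤m)

∑-sampled-sampled : ∀ {w j m} (x y : Vec Bool w) → x ≢ y → j ≤ m →
  4 ^ j * ∑ (seeds w m) (λ s → ⟦ sampled j s x ⟧ * ⟦ sampled j s y ⟧) ≡ length (seeds w m)
∑-sampled-sampled {w} {j} {m} x y x≢y j≤m =
  trans (cong (4 ^ j *_) (∑-cong (seeds w m) (λ s →
           trans (cong₂ _*_ (sampled≡weight j s x) (sampled≡weight j s y))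
                 (sym (weight-* _ _ j s)))))
    (∑-weight _ 4 (trans (*-assoc 2 2 (∑ (rows w) (λ r → ⟦ hit r x ⟧ * ⟦ hit r y ⟧)))
                    (trans (cong (2 *_) (∑-hit-hit x y x≢y))
                    (sym (length-vectors bits (suc w))))) j≤m)

-- Nodes of the complete binary tree of height h

data Node : ℕ → Set where
  top : ∀ {h} → Node h
  inˡ : ∀ {h} → Node h → Node (suc h)
  inʳ : ∀ {h} → Node h → Node (suc h)

nodes : ∀ h → List (Node h)
nodes zero    = top ∷ []
nodes (suc h) = top ∷ map inˡ (nodes h) ++ map inʳ (nodes h)

∑-nodes : ∀ h (f : Node (suc h) → ℕ) →
          ∑ (nodes (suc h)) f ≡ f top + (∑ (nodes h) (f ∘ inˡ) + ∑ (nodes h) (f ∘ inʳ))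
∑-nodes h f = cong (_+_ (f top)) (trans (∑-++ (map inˡ (nodes h)) _ f)
  (cong₂ _+_ (∑-map inˡ (nodes h) f) (∑-map inʳ (nodes h) f)))

-- Two bits per depth, whether to descend and to which side, give all nodes words of one length, as
-- hashing and a memory of fixed size require.
code : ∀ {h} → Node h → Vec Bool (h * 2)
code {zero}  top     = []
code {suc h} top     = false ∷ false ∷ code {h} top
code         (inˡ u) = true ∷ false ∷ code u
code         (inʳ u) = true ∷ true ∷ code u

fromCode : ∀ {h} → Vec Bool (h * 2) → Node h
fromCode {zero}  []                 = top
fromCode {suc h} (false ∷ _ ∷ _)    = top
fromCode {suc h} (true ∷ false ∷ v) = inˡ (fromCode v)
fromCode {suc h} (true ∷ true ∷ v)  = inʳ (fromCode v)

fromCode-code : ∀ {h} (u : Node h) → fromCode (code u) ≡ u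
fromCode-code {zero}  top     = refl
fromCode-code {suc h} top     = refl
fromCode-code         (inˡ u) = cong inˡ (fromCode-code u)
fromCode-code         (inʳ u) = cong inʳ (fromCode-code u)

code-injective : ∀ {h} {u v : Node h} → code u ≡ code v → u ≡ v
code-injective {u = u} {v} eq =
  trans (sym (fromCode-code u)) (trans (cong fromCode eq) (fromCode-code v))

_≟ᴺ_ : ∀ {h} (u v : Node h) → Dec (u ≡ v)
top   ≟ᴺ top   = yes refl
top   ≟ᴺ inˡ v = no λ ()
top   ≟ᴺ inʳ v = no λ ()
inˡ u ≟ᴺ top   = no λ ()
inˡ u ≟ᴺ inˡ v with u ≟ᴺ v
... | yes refl = yes refl
... | no  u≢v  = no λ { refl → u≢v refl }
inˡ u ≟ᴺ inʳ v = no λ ()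
inʳ u ≟ᴺ top   = no λ ()
inʳ u ≟ᴺ inˡ v = no λ ()
inʳ u ≟ᴺ inʳ v with u ≟ᴺ v
... | yes refl = yes refl
... | no  u≢v  = no λ { refl → u≢v refl }

δ : ∀ {h} → Node h → Node h → ℕ
δ u v = ⟦ does (u ≟ᴺ v) ⟧

private
  ∑-zero : ∀ {A : Set} (xs : List A) → ∑ xs (λ _ → 0) ≡ 0
  ∑-zero xs = trans (∑-const xs 0) (*-zeroʳ (length xs))

  δ-inˡ : ∀ {h} (u v : Node h) → δ (inˡ u) (inˡ v) ≡ δ u v
  δ-inˡ u v with u ≟ᴺ v
  ... | yes refl = refl
  ... | no  _    = refl

  δ-inʳ : ∀ {h} (u v : Node h) → δ (inʳ u) (inʳ v) ≡ δ u v
  δ-inʳ u v with u ≟ᴺ v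
  ... | yes refl = refl
  ... | no  _    = refl

∑-δ : ∀ {h} (u : Node h) (f : Node h → ℕ) → ∑ (nodes h) (λ v → δ u v * f v) ≡ f u
∑-δ {zero}  top f = trans (+-identityʳ _) (+-identityʳ _)
∑-δ {suc h} top f = trans (∑-nodes h _)
  (trans (cong₂ _+_ (+-identityʳ (f top)) (cong₂ _+_ (∑-zero (nodes h)) (∑-zero (nodes h))))
         (+-identityʳ _))
∑-δ {suc h} (inˡ u) f = trans (∑-nodes h (λ v → δ (inˡ u) v * f v))
  (trans (cong₂ _+_ (trans (∑-cong (nodes h) (λ v → cong (_* f (inˡ v)) (δ-inˡ u v)))
                           (∑-δ u (f ∘ inˡ)))
                    (∑-zero (nodes h)))
         (+-identityʳ _))
∑-δ {suc h} (inʳ u) f = trans (∑-nodes h (λ v → δ (inʳ u) v * f v))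
  (cong₂ _+_ (∑-zero (nodes h))
             (trans (∑-cong (nodes h) (λ v → cong (_* f (inʳ v)) (δ-inʳ u v)))
                    (∑-δ u (f ∘ inʳ))))

-- The second moment method

kept : ∀ {h m} → ℕ → Seed (h * 2) m → Node h → Bool
kept j s u = sampled j s (code u)

estimate : ∀ {h m} → ℕ → Seed (h * 2) m → (Node h → ℕ) → ℕ
estimate {h} j s d = 2 ^ j * ∑ (nodes h) (λ u → ⟦ kept j s u ⟧ * d u)

⟦does⟧*≤ : ∀ {P : Set} (p? : Dec P) {a b} → (P → a ≤ b) → ⟦ does p? ⟧ * a ≤ b
⟦does⟧*≤ (yes p) {a} f = ≤-trans (≤-reflexive (*-identityˡ a)) (f p)
⟦does⟧*≤ (no _)      f = z≤n

-- Up to the factor g, the variance 2^j - 1 of the estimate at level j.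
excess : ℕ → ℕ
excess zero    = 0
excess (suc j) = suc (2 * excess j)

2^≡1+excess : ∀ j → 2 ^ j ≡ suc (excess j)
2^≡1+excess zero    = refl
2^≡1+excess (suc j) rewrite 2^≡1+excess j = lemma (excess j)
  where
  lemma : ∀ k → 2 * suc k ≡ suc (suc (2 * k))
  lemma = solve-∀

-- The square of a difference, with the cross term moved to the left because subtraction of natural
-- numbers truncates.
∣-∣² : ∀ a b → ∣ a - b ∣ * ∣ a - b ∣ + 2 * (a * b) ≡ a * a + b * b
∣-∣² zero    b       = lemma b
  where
  lemma : ∀ b → b * b + 0 ≡ b * b
  lemma = solve-∀
∣-∣² (suc a) zero    rewrite *-zeroʳ a = refl
∣-∣² (suc a) (suc b) = begin
  ∣ a - b ∣ * ∣ a - b ∣ + 2 * (suc a * suc b)            ≡⟨ l₁ ∣ a - b ∣ a b ⟩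
  ∣ a - b ∣ * ∣ a - b ∣ + 2 * (a * b) + 2 * (a + b + 1)  ≡⟨ cong (_+ 2 * (a + b + 1)) (∣-∣² a b) ⟩
  a * a + b * b + 2 * (a + b + 1)                        ≡⟨ l₂ a b ⟩
  suc a * suc a + suc b * suc b                          ∎
  where
  open ≡-Reasoning
  l₁ : ∀ x a b → x * x + 2 * ((1 + a) * (1 + b)) ≡ x * x + 2 * (a * b) + 2 * (a + b + 1)
  l₁ = solve-∀
  l₂ : ∀ a b → a * a + b * b + 2 * (a + b + 1) ≡ (1 + a) * (1 + a) + (1 + b) * (1 + b)
  l₂ = solve-∀

4^≡2^*2^ : ∀ j → 4 ^ j ≡ 2 ^ j * 2 ^ j
4^≡2^*2^ zero    = refl
4^≡2^*2^ (suc j) = trans (cong (4 *_) (4^≡2^*2^ j)) (lemma (2 ^ j))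
  where
  lemma : ∀ a → 4 * (a * a) ≡ 2 * a * (2 * a)
  lemma = solve-∀

module Moments {h m : ℕ} (d : Node h → ℕ) (d≤1 : ∀ u → d u ≤ 1) where

  𝕊 : List (Seed (h * 2) m)
  𝕊 = seeds (h * 2) m

  N g : ℕ
  N = length 𝕊
  g = ∑ (nodes h) d

  ∑-kept : ∀ {j} → j ≤ m → ∀ (u : Node h) → 2 ^ j * ∑ 𝕊 (λ s → ⟦ kept j s u ⟧) ≡ N
  ∑-kept j≤m u = ∑-sampled (code u) j≤m

  ∑-weighted : ∀ {j} → j ≤ m → ∀ (f : Node h → ℕ) →
    2 ^ j * ∑ 𝕊 (λ s → ∑ (nodes h) (λ u → ⟦ kept j s u ⟧ * f u)) ≡ N * ∑ (nodes h) f
  ∑-weighted {j} j≤m f = begin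
    2 ^ j * ∑ 𝕊 (λ s → ∑ (nodes h) (λ u → ⟦ kept j s u ⟧ * f u))
      ≡⟨ cong (2 ^ j *_) (∑-swap 𝕊 (nodes h) _) ⟩
    2 ^ j * ∑ (nodes h) (λ u → ∑ 𝕊 (λ s → ⟦ kept j s u ⟧ * f u))
      ≡⟨ sym (∑-*ˡ (2 ^ j) (nodes h) _) ⟩
    ∑ (nodes h) (λ u → 2 ^ j * ∑ 𝕊 (λ s → ⟦ kept j s u ⟧ * f u))
      ≡⟨ ∑-cong (nodes h) (λ u → trans (cong (2 ^ j *_) (∑-*ʳ 𝕊 _ (f u)))
           (trans (sym (*-assoc (2 ^ j) _ (f u))) (cong (_* f u) (∑-kept j≤m u)))) ⟩
    ∑ (nodes h) (λ u → N * f u)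
      ≡⟨ ∑-*ˡ N (nodes h) f ⟩
    N * ∑ (nodes h) f ∎
    where open ≡-Reasoning

  ∑-estimate : ∀ {j} → j ≤ m → ∑ 𝕊 (λ s → estimate j s d) ≡ N * g
  ∑-estimate {j} j≤m = trans (∑-*ˡ (2 ^ j) 𝕊 _) (∑-weighted j≤m d)

  -- Off the diagonal this is pairwise independence. On it the indicator is idempotent, and 2ʲ `N`
  -- exceeds `N` by `excess j * N`.
  ∑-kept-kept : ∀ {j} → j ≤ m → ∀ (u v : Node h) →
    4 ^ j * ∑ 𝕊 (λ s → ⟦ kept j s u ⟧ * ⟦ kept j s v ⟧) ≤ N + δ u v * (excess j * N)
  ∑-kept-kept {j} j≤m u v with u ≟ᴺ v
  ... | yes refl = ≤-reflexive (begin
    4 ^ j * ∑ 𝕊 (λ s → ⟦ kept j s u ⟧ * ⟦ kept j s u ⟧)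
      ≡⟨ cong₂ _*_ (4^≡2^*2^ j) (∑-cong 𝕊 (λ s → ⟦⟧-idem (kept j s u))) ⟩
    2 ^ j * 2 ^ j * ∑ 𝕊 (λ s → ⟦ kept j s u ⟧)
      ≡⟨ trans (*-assoc (2 ^ j) (2 ^ j) _) (cong (2 ^ j *_) (∑-kept j≤m u)) ⟩
    2 ^ j * N
      ≡⟨ cong (_* N) (2^≡1+excess j) ⟩
    N + excess j * N
      ≡⟨ cong (_+_ N) (sym (*-identityˡ _)) ⟩
    N + 1 * (excess j * N) ∎)
    where open ≡-Reasoning
  ... | no u≢v = ≤-reflexive (trans (∑-sampled-sampled (code u) (code v) (u≢v ∘ code-injective {h}) j≤m)
                   (sym (+-identityʳ N)))

  ∑-estimate² : ∀ {j} → j ≤ m →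
    ∑ 𝕊 (λ s → estimate j s d * estimate j s d) ≤ N * (g * g) + excess j * N * g
  ∑-estimate² {j} j≤m = begin
    ∑ 𝕊 (λ s → estimate j s d * estimate j s d)
      ≡⟨ ∑-cong 𝕊 (λ s → expand s) ⟩
    ∑ 𝕊 (λ s → 4 ^ j * ∑ (nodes h) (λ u → ∑ (nodes h) (λ v → term s u v)))
      ≡⟨ ∑-*ˡ (4 ^ j) 𝕊 _ ⟩
    4 ^ j * ∑ 𝕊 (λ s → ∑ (nodes h) (λ u → ∑ (nodes h) (λ v → term s u v)))
      ≡⟨ cong (4 ^ j *_) (trans (∑-swap 𝕊 (nodes h) _)
           (∑-cong (nodes h) (λ u → ∑-swap 𝕊 (nodes h) (λ s v → term s u v)))) ⟩
    4 ^ j * ∑ (nodes h) (λ u → ∑ (nodes h) (λ v → ∑ 𝕊 (λ s → term s u v)))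
      ≡⟨ sym (trans (∑-cong (nodes h) (λ u → ∑-*ˡ (4 ^ j) (nodes h) _)) (∑-*ˡ (4 ^ j) (nodes h) _)) ⟩
    ∑ (nodes h) (λ u → ∑ (nodes h) (λ v → 4 ^ j * ∑ 𝕊 (λ s → term s u v)))
      ≤⟨ ∑-mono (nodes h) (λ u → ∑-mono (nodes h) (λ v → bound u v)) ⟩
    ∑ (nodes h) (λ u → ∑ (nodes h) (λ v → N * (d u * d v) + excess j * N * (δ u v * (d u * d v))))
      ≡⟨ ∑-cong (nodes h) (λ u → trans (∑-+ (nodes h) _ _) (cong₂ _+_
           (trans (∑-*ˡ N (nodes h) _) (cong (N *_) (∑-*ˡ (d u) (nodes h) d)))
           (trans (∑-*ˡ (excess j * N) (nodes h) _)
             (cong (excess j * N *_) (∑-δ u (λ v → d u * d v)))))) ⟩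
    ∑ (nodes h) (λ u → N * (d u * g) + excess j * N * (d u * d u))
      -- Since `d u` is 0 or 1, its square is at most `d u`, so the diagonal contributes only
      -- linearly in `g`.
      ≤⟨ ∑-mono (nodes h) (λ u → +-monoʳ-≤ (N * (d u * g)) (*-monoʳ-≤ (excess j * N)
           (≤-trans (*-monoʳ-≤ (d u) (d≤1 u)) (≤-reflexive (*-identityʳ (d u)))))) ⟩
    ∑ (nodes h) (λ u → N * (d u * g) + excess j * N * d u)
      ≡⟨ trans (∑-+ (nodes h) _ _) (cong₂ _+_
           (trans (∑-*ˡ N (nodes h) _) (cong (N *_) (∑-*ʳ (nodes h) d g)))
           (∑-*ˡ (excess j * N) (nodes h) d)) ⟩
    N * (g * g) + excess j * N * g ∎
    where
    open ≤-Reasoning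
    term : Seed (h * 2) m → Node h → Node h → ℕ
    term s u v = ⟦ kept j s u ⟧ * d u * (⟦ kept j s v ⟧ * d v)
    expand : ∀ s → estimate j s d * estimate j s d ≡
                   4 ^ j * ∑ (nodes h) (λ u → ∑ (nodes h) (λ v → term s u v))
    expand s = trans (lemma (2 ^ j) (∑ (nodes h) (λ u → ⟦ kept j s u ⟧ * d u)))
      (cong₂ _*_ (sym (4^≡2^*2^ j)) (∑-*-∑ (nodes h) (nodes h) _ _))
      where
      lemma : ∀ a b → a * b * (a * b) ≡ a * a * (b * b)
      lemma = solve-∀
    bound : ∀ (u v : Node h) → 4 ^ j * ∑ 𝕊 (λ s → term s u v) ≤
                    N * (d u * d v) + excess j * N * (δ u v * (d u * d v))
    bound u v = begin
      4 ^ j * ∑ 𝕊 (λ s → term s u v)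
        ≡⟨ cong (4 ^ j *_) (trans (∑-cong 𝕊 (λ s → lemma ⟦ kept j s u ⟧ (d u) ⟦ kept j s v ⟧ (d v)))
             (∑-*ʳ 𝕊 _ (d u * d v))) ⟩
      4 ^ j * (∑ 𝕊 (λ s → ⟦ kept j s u ⟧ * ⟦ kept j s v ⟧) * (d u * d v))
        ≡⟨ sym (*-assoc (4 ^ j) _ (d u * d v)) ⟩
      4 ^ j * ∑ 𝕊 (λ s → ⟦ kept j s u ⟧ * ⟦ kept j s v ⟧) * (d u * d v)
        ≤⟨ *-monoˡ-≤ (d u * d v) (∑-kept-kept j≤m u v) ⟩
      (N + δ u v * (excess j * N)) * (d u * d v)
        ≡⟨ lemma₂ N (δ u v) (excess j) (d u) (d v) ⟩
      N * (d u * d v) + excess j * N * (δ u v * (d u * d v)) ∎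
      where
      lemma : ∀ a b c e → a * b * (c * e) ≡ a * c * (b * e)
      lemma = solve-∀
      lemma₂ : ∀ n x q a b → (n + x * (q * n)) * (a * b) ≡ n * (a * b) + q * n * (x * (a * b))
      lemma₂ = solve-∀

  -- The variance is the second moment minus the squared mean; twice `N * (g * g)` is added to both
  -- sides to avoid the subtraction.
  ∑-deviation² : ∀ {j} → j ≤ m →
    ∑ 𝕊 (λ s → ∣ estimate j s d - g ∣ * ∣ estimate j s d - g ∣) ≤ excess j * N * g
  ∑-deviation² {j} j≤m = +-cancelʳ-≤ (2 * (N * (g * g))) _ _ (begin
    ∑ 𝕊 (λ s → Δ s * Δ s) + 2 * (N * (g * g))
      ≡⟨ cong (_+_ (∑ 𝕊 (λ s → Δ s * Δ s))) (sym cross) ⟩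
    ∑ 𝕊 (λ s → Δ s * Δ s) + ∑ 𝕊 (λ s → 2 * (Z s * g))
      ≡⟨ sym (∑-+ 𝕊 _ _) ⟩
    ∑ 𝕊 (λ s → Δ s * Δ s + 2 * (Z s * g))
      ≡⟨ ∑-cong 𝕊 (λ s → ∣-∣² (Z s) g) ⟩
    ∑ 𝕊 (λ s → Z s * Z s + g * g)
      ≡⟨ trans (∑-+ 𝕊 _ _) (cong (_+_ (∑ 𝕊 (λ s → Z s * Z s))) (∑-const 𝕊 (g * g))) ⟩
    ∑ 𝕊 (λ s → Z s * Z s) + N * (g * g)
      ≤⟨ +-monoˡ-≤ (N * (g * g)) (∑-estimate² j≤m) ⟩
    N * (g * g) + excess j * N * g + N * (g * g)
      ≡⟨ lemma (N * (g * g)) (excess j * N * g) ⟩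
    excess j * N * g + 2 * (N * (g * g)) ∎)
    where
    open ≤-Reasoning
    Z Δ : Seed (h * 2) m → ℕ
    Z s = estimate j s d
    Δ s = ∣ Z s - g ∣
    cross : ∑ 𝕊 (λ s → 2 * (Z s * g)) ≡ 2 * (N * (g * g))
    cross = trans (∑-*ˡ 2 𝕊 _) (cong (2 *_) (trans (∑-*ʳ 𝕊 Z g)
      (trans (cong (_* g) (∑-estimate j≤m)) (*-assoc N g g))))
    lemma : ∀ a b → a + b + a ≡ b + 2 * a
    lemma = solve-∀

  far : ℕ → ℕ → Seed (h * 2) m → Bool
  far E j s = does (g <? E * ∣ estimate j s d - g ∣)

  -- The strict inequality in `far` yields `suc g`, which can be cancelled even when `g` is 0.
  chebyshev : ∀ E {j} → j ≤ m → ∑ 𝕊 (λ s → ⟦ far E j s ⟧) * suc g ≤ E * E * (excess j * N)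
  chebyshev E {j} j≤m = *-cancelʳ-≤ _ _ (suc g) (begin
    ∑ 𝕊 (λ s → ⟦ far E j s ⟧) * suc g * suc g
      ≡⟨ trans (*-assoc (∑ 𝕊 (λ s → ⟦ far E j s ⟧)) (suc g) (suc g))
           (sym (∑-*ʳ 𝕊 (λ s → ⟦ far E j s ⟧) (suc g * suc g))) ⟩
    ∑ 𝕊 (λ s → ⟦ far E j s ⟧ * (suc g * suc g))
      ≤⟨ ∑-mono 𝕊 pointwise ⟩
    ∑ 𝕊 (λ s → E * E * (Δ s * Δ s))
      ≡⟨ ∑-*ˡ (E * E) 𝕊 _ ⟩
    E * E * ∑ 𝕊 (λ s → Δ s * Δ s)
      ≤⟨ *-monoʳ-≤ (E * E) (∑-deviation² j≤m) ⟩
    E * E * (excess j * N * g)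
      ≤⟨ *-monoʳ-≤ (E * E) (*-monoʳ-≤ (excess j * N) (n≤1+n g)) ⟩
    E * E * (excess j * N * suc g)
      ≡⟨ sym (*-assoc (E * E) (excess j * N) (suc g)) ⟩
    E * E * (excess j * N) * suc g ∎)
    where
    open ≤-Reasoning
    Δ : Seed (h * 2) m → ℕ
    Δ s = ∣ estimate j s d - g ∣
    pointwise : ∀ s → ⟦ far E j s ⟧ * (suc g * suc g) ≤ E * E * (Δ s * Δ s)
    pointwise s = ⟦does⟧*≤ (g <? E * Δ s) (λ g<Δ → begin
      suc g * suc g         ≤⟨ *-mono-≤ g<Δ g<Δ ⟩
      E * Δ s * (E * Δ s)   ≡⟨ lemma E (Δ s) ⟩
      E * E * (Δ s * Δ s)   ∎)
      where
      lemma : ∀ a b → a * b * (a * b) ≡ a * a * (b * b)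
      lemma = solve-∀

-- This level belongs to the analysis alone, since the algorithm does not know `g`. The lower bound
-- on `g` serves the accuracy of all levels up to `j`, the upper bound the size of the table at
-- level `j`.
∃-level : ∀ K g m → g < excess (suc m) * K →
          ∃[ j ] j ≤ m × excess j * K ≤ g × g ≤ excess (suc j) * K
∃-level K g zero    g< = 0 , z≤n , z≤n , <⇒≤ g<
∃-level K g (suc m) g< with excess (suc m) * K ≤? g
... | yes ≤g = suc m , ≤-refl , ≤g , <⇒≤ g<
... | no  ≰g = let j , j≤m , p = ∃-level K g m (≰⇒> ≰g) in j , m≤n⇒m≤1+n j≤m , p

-- Union bound over the levels

module Accuracy {h m : ℕ} (d : Node h → ℕ) (d≤1 : ∀ u → d u ≤ 1)
                (size : ℕ → Seed (h * 2) m → ℕ) (E P : ℕ) where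

  open Moments {h} {m} d d≤1

  -- Counts the inaccurate levels among 0, ..., `j`. None is tolerated, because the seed decides
  -- which of these levels is read.
  faults : ℕ → Seed (h * 2) m → ℕ
  faults zero    s = ⟦ far E zero s ⟧
  faults (suc j) s = ⟦ far E (suc j) s ⟧ + faults j s

  private
    ≮-from-⟦⟧≡0 : ∀ {a b} (p? : Dec (a < b)) → ⟦ does p? ⟧ ≡ 0 → b ≤ a
    ≮-from-⟦⟧≡0 (no ≮) _ = ≮⇒≥ ≮

  faults≡0⇒accurate : ∀ {i j s} → i ≤ j → faults j s ≡ 0 → E * ∣ estimate i s d - g ∣ ≤ g
  faults≡0⇒accurate {j = zero}  z≤n eq = ≮-from-⟦⟧≡0 (g <? _) eq
  faults≡0⇒accurate {i} {suc j} {s} i≤ eq with m≤n⇒m<n∨m≡n i≤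
  ... | inj₁ (s≤s i≤j) = faults≡0⇒accurate i≤j (m+n≡0⇒n≡0 ⟦ far E (suc j) s ⟧ eq)
  ... | inj₂ refl = ≮-from-⟦⟧≡0 (g <? _) (m+n≡0⇒m≡0 ⟦ far E (suc j) s ⟧ eq)

  -- Since the bounds from Chebyshev's inequality grow geometrically with the
  -- level, a union over all levels up to j costs only a factor 2.
  ∑-faults : ∀ {j} → j ≤ m → ∑ 𝕊 (faults j) * suc g ≤ E * E * (2 * excess j * N)
  ∑-faults {zero}  j≤m = chebyshev E j≤m
  ∑-faults {suc j} j≤m = begin
    ∑ 𝕊 (faults (suc j)) * suc g
      ≡⟨ trans (cong (_* suc g) (∑-+ 𝕊 _ (faults j)))
           (*-distribʳ-+ (suc g) (∑ 𝕊 (λ s → ⟦ far E (suc j) s ⟧)) (∑ 𝕊 (faults j))) ⟩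
    ∑ 𝕊 (λ s → ⟦ far E (suc j) s ⟧) * suc g + ∑ 𝕊 (faults j) * suc g
      ≤⟨ +-mono-≤ (chebyshev E j≤m) (∑-faults (<⇒≤ j≤m)) ⟩
    E * E * (excess (suc j) * N) + E * E * (2 * excess j * N)
      ≡⟨ lemma₁ (E * E) (excess j) N ⟩
    E * E * ((1 + 4 * excess j) * N)
      ≤⟨ *-monoʳ-≤ (E * E) (*-monoˡ-≤ N (n≤1+n (1 + 4 * excess j))) ⟩
    E * E * ((2 + 4 * excess j) * N)
      ≡⟨ lemma₂ (E * E) (excess j) N ⟩
    E * E * (2 * excess (suc j) * N) ∎
    where
    open ≤-Reasoning
    lemma₁ : ∀ e x n → e * ((1 + 2 * x) * n) + e * (2 * x * n) ≡ e * ((1 + 4 * x) * n)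
    lemma₁ = solve-∀
    lemma₂ : ∀ e x n → e * ((2 + 4 * x) * n) ≡ e * (2 * (1 + 2 * x) * n)
    lemma₂ = solve-∀

  Accurate : ℕ → Seed (h * 2) m → Set
  Accurate j s = size j s ≤ 12 * P × faults j s ≡ 0

  accurate? : ∀ j s → Dec (Accurate j s)
  accurate? j s = (size j s ≤? 12 * P) ×-dec (faults j s ≟ 0)

  module _ .{{_ : NonZero P}} {j} (j≤m : j ≤ m)
           (lo : excess j * (8 * (E * E)) ≤ g)
           (∑-size : 2 ^ j * ∑ 𝕊 (size j) ≤ N * (2 ^ j * P)) where

    few-faults : 4 * ∑ 𝕊 (faults j) ≤ N
    few-faults = *-cancelʳ-≤ _ _ (suc g) (begin
      4 * ∑ 𝕊 (faults j) * suc g          ≡⟨ *-assoc 4 (∑ 𝕊 (faults j)) (suc g) ⟩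
      4 * (∑ 𝕊 (faults j) * suc g)        ≤⟨ *-monoʳ-≤ 4 (∑-faults j≤m) ⟩
      4 * (E * E * (2 * excess j * N))    ≡⟨ lemma (E * E) (excess j) N ⟩
      N * (excess j * (8 * (E * E)))      ≤⟨ *-monoʳ-≤ N (≤-trans lo (n≤1+n g)) ⟩
      N * suc g                           ∎)
      where
      open ≤-Reasoning
      lemma : ∀ e x n → 4 * (e * (2 * x * n)) ≡ n * (x * (8 * e))
      lemma = solve-∀

    oversized : Seed (h * 2) m → ℕ
    oversized s = ⟦ does (12 * P <? size j s) ⟧

    -- Markov's inequality: `∑-size` bounds the mean size by `P`, and an oversized table exceeds
    -- `12 * P`.
    few-oversized : 12 * ∑ 𝕊 oversized ≤ N
    few-oversized = *-cancelʳ-≤ _ _ P (begin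
      12 * ∑ 𝕊 oversized * P
        ≡⟨ trans (lemma (∑ 𝕊 oversized) P) (sym (∑-*ʳ 𝕊 oversized (12 * P))) ⟩
      ∑ 𝕊 (λ s → oversized s * (12 * P))
        ≤⟨ ∑-mono 𝕊 (λ s → ⟦does⟧*≤ (12 * P <? size j s) <⇒≤) ⟩
      ∑ 𝕊 (size j)
        ≤⟨ *-cancelˡ-≤ (2 ^ j) {{m^n≢0 2 j}} (≤-trans ∑-size (≤-reflexive (lemma₂ N (2 ^ j) P))) ⟩
      N * P ∎)
      where
      open ≤-Reasoning
      lemma : ∀ a p → 12 * a * p ≡ a * (12 * p)
      lemma = solve-∀
      lemma₂ : ∀ n b p → n * (b * p) ≡ b * (n * p)
      lemma₂ = solve-∀

    covering : ∀ s → 1 ≤ ⟦ does (accurate? j s) ⟧ + (oversized s + faults j s)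
    covering s = go (size j s ≤? 12 * P) (faults j s ≟ 0) (12 * P <? size j s)
      where
      go : ∀ {b f} (p : Dec (size j s ≤ b)) (q : Dec (f ≡ 0)) (r : Dec (b < size j s)) →
           1 ≤ ⟦ does (p ×-dec q) ⟧ + (⟦ does r ⟧ + f)
      go (yes p) (yes q) r       = s≤s z≤n
      go (yes p) (no ¬q) r       = ≤-trans (n≢0⇒n>0 ¬q) (m≤n+m _ ⟦ does r ⟧)
      go (no ¬p) q       (yes r) = s≤s z≤n
      go (no ¬p) q       (no ¬r) = ⊥-elim (¬r (≰⇒> ¬p))

    -- The bad seeds make up at most 1/12 + 1/4 = 1/3 of all seeds; the factor 12 clears both
    -- denominators.
    mostly-accurate : 2 * N ≤ 3 * ∑ 𝕊 (λ s → ⟦ does (accurate? j s) ⟧)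
    mostly-accurate = *-cancelˡ-≤ 4 (+-cancelʳ-≤ (4 * N) _ _ (begin
      4 * (2 * N) + 4 * N          ≡⟨ lemma₁ N ⟩
      12 * N                       ≡⟨ cong (12 *_) (sym (trans (∑-const 𝕊 1) (*-identityʳ N))) ⟩
      12 * ∑ 𝕊 (λ _ → 1)           ≤⟨ *-monoʳ-≤ 12 (∑-mono 𝕊 covering) ⟩
      12 * ∑ 𝕊 (λ s → ⟦ does (accurate? j s) ⟧ + (oversized s + faults j s))
        ≡⟨ cong (12 *_) (trans (∑-+ 𝕊 _ _) (cong (_+_ A) (∑-+ 𝕊 oversized (faults j)))) ⟩
      12 * (A + (O + F))           ≡⟨ lemma₂ A O F ⟩
      4 * (3 * A) + (12 * O + 3 * (4 * F))
        ≤⟨ +-monoʳ-≤ (4 * (3 * A)) (+-mono-≤ few-oversized (*-monoʳ-≤ 3 few-faults)) ⟩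
      4 * (3 * A) + 4 * N          ∎))
      where
      open ≤-Reasoning
      A O F : ℕ
      A = ∑ 𝕊 (λ s → ⟦ does (accurate? j s) ⟧)
      O = ∑ 𝕊 oversized
      F = ∑ 𝕊 (faults j)
      lemma₁ : ∀ n → 4 * (2 * n) + 4 * n ≡ 12 * n
      lemma₁ = solve-∀
      lemma₂ : ∀ a o f → 12 * (a + (o + f)) ≡ 4 * (3 * a) + (12 * o + 3 * (4 * f))
      lemma₂ = solve-∀

-- Chain F hi lo k: there are k pairwise disjoint windows [x , y] ⊆ [lo , hi) with F x y.

data Chain (F : ℕ → ℕ → Set) (hi : ℕ) : ℕ → ℕ → Set where
  stop : ∀ {lo} → lo ≤ hi → Chain F hi lo 0
  link : ∀ {lo k x y} → lo ≤ x → x ≤ y → F x y → Chain F hi (suc y) k → Chain F hi lo (suc k)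

module _ {F : ℕ → ℕ → Set} where

  chain-length : ∀ {hi lo k} → Chain F hi lo k → lo + k ≤ hi
  chain-length {lo = lo} (stop lo≤hi) = ≤-trans (≤-reflexive (+-identityʳ lo)) lo≤hi
  chain-length {hi} {lo} {suc k} (link {y = y} lo≤x x≤y _ c) = begin
    lo + suc k  ≡⟨ +-suc lo k ⟩
    suc lo + k  ≤⟨ +-monoˡ-≤ k (s≤s (≤-trans lo≤x x≤y)) ⟩
    suc y + k   ≤⟨ chain-length c ⟩
    hi          ∎
    where open ≤-Reasoning

  chain-bounds : ∀ {hi lo k} → Chain F hi lo k → lo ≤ hi
  chain-bounds {lo = lo} c = ≤-trans (m≤m+n lo _) (chain-length c)

  recast : ∀ {hi hi′ lo k} → hi ≡ hi′ → Chain F hi lo k → Chain F hi′ lo k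
  recast refl c = c

  weakenˡ : ∀ {hi lo lo′ k} → lo′ ≤ lo → Chain F hi lo k → Chain F hi lo′ k
  weakenˡ ≤lo (stop lo≤hi)         = stop (≤-trans ≤lo lo≤hi)
  weakenˡ ≤lo (link lo≤x x≤y fxy c) = link (≤-trans ≤lo lo≤x) x≤y fxy c

  _⌢_ : ∀ {hi mid lo k l} → Chain F mid lo k → Chain F hi mid l → Chain F hi lo (k + l)
  stop lo≤mid         ⌢ c′ = weakenˡ lo≤mid c′
  link lo≤x x≤y fxy c ⌢ c′ = link lo≤x x≤y fxy (c ⌢ c′)

  -- Dropping the first window that reaches `mid` suffices: those before it end left of `mid`, those
  -- after it start right of `mid`.
  chain-split : ∀ {hi lo k} mid → lo ≤ mid → mid ≤ hi → Chain F hi lo k →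
                ∃[ a ] ∃[ b ] Chain F mid lo a × Chain F hi mid b × k ≤ suc (a + b)
  chain-split mid lo≤mid mid≤hi (stop _) = 0 , 0 , stop lo≤mid , stop mid≤hi , z≤n
  chain-split mid lo≤mid mid≤hi (link {y = y} lo≤x x≤y fxy c) with suc y ≤? mid
  ... | yes y<mid = let a , b , c₁ , c₂ , k≤ = chain-split mid y<mid mid≤hi c in
                    suc a , b , link lo≤x x≤y fxy c₁ , c₂ , s≤s k≤
  ... | no  y≮mid = 0 , _ , stop lo≤mid , weakenˡ (<⇒≤ (≰⇒> y≮mid)) c , ≤-refl

chain-map : ∀ {F G : ℕ → ℕ → Set} {hi lo k} →
            (∀ {x y} → lo ≤ x → x ≤ y → y < hi → F x y → G x y) →
            Chain F hi lo k → Chain G hi lo k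
chain-map f (stop lo≤hi)           = stop lo≤hi
chain-map f (link lo≤x x≤y fxy c) = link lo≤x x≤y (f lo≤x x≤y (chain-bounds c) fxy)
  (chain-map (λ y<x′ → f (≤-trans lo≤x (≤-trans x≤y (<⇒≤ y<x′)))) c)

module Greedy {F : ℕ → ℕ → Set} (F? : Decidable F) where

  endsAt? : ∀ lo y → Dec (∃[ x ] x < suc y × lo ≤ x × F x y)
  endsAt? lo y = anyUpTo? (λ x → (lo ≤? x) ×-dec F? x y) (suc y)

  -- Windows ending before y have already been ruled out.
  scan : (lo y n : ℕ) → ℕ
  scan lo y zero    = 0
  scan lo y (suc n) with endsAt? lo y
  ... | yes _ = suc (scan (suc y) (suc y) n)
  ... | no  _ = scan lo (suc y) n

  scan-chain : ∀ lo y n → lo ≤ y → Chain F (n + y) lo (scan lo y n)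
  scan-chain lo y zero    lo≤y = stop lo≤y
  scan-chain lo y (suc n) lo≤y with endsAt? lo y
  ... | yes (x , s≤s x≤y , lo≤x , fxy) = link lo≤x x≤y fxy
          (recast (+-suc n y)
                 (scan-chain (suc y) (suc y) n ≤-refl))
  ... | no _ = recast (+-suc n y)
                 (scan-chain lo (suc y) n (m≤n⇒m≤1+n lo≤y))

  -- Exchange argument of interval scheduling: the scan stops at the earliest possible right end, so
  -- whatever fits after `z` fits after its choice as well.
  scan-max : ∀ lo y n {k x z} → lo ≤ x → x ≤ z → F x z → y ≤ z →
             Chain F (n + y) (suc z) k → suc k ≤ scan lo y n
  scan-max lo y zero    lo≤x x≤z fxz y≤z c = ⊥-elim (<⇒≱ (chain-bounds c) y≤z)
  scan-max lo y (suc n) lo≤x x≤z fxz y≤z c with endsAt? lo y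
  ... | yes _ = s≤s (tail c)
    where
    tail : ∀ {k} → Chain F (suc n + y) (suc _) k → k ≤ scan (suc y) (suc y) n
    tail (stop _) = z≤n
    tail (link z<x′ x′≤z′ f c′) = scan-max (suc y) (suc y) n (≤-trans (s≤s y≤z) z<x′) x′≤z′ f
      (≤-trans (≤-trans (s≤s y≤z) z<x′) x′≤z′)
      (recast (sym (+-suc n y)) c′)
  ... | no none with m≤n⇒m<n∨m≡n y≤z
  ...   | inj₁ y<z  = scan-max lo (suc y) n lo≤x x≤z fxz y<z
                        (recast (sym (+-suc n y)) c)
  ...   | inj₂ refl = ⊥-elim (none (_ , s≤s x≤z , lo≤x , fxz))

  longest : (lo n : ℕ) → ℕ
  longest lo n = scan lo lo n

  longest-chain : ∀ lo n → Chain F (lo + n) lo (longest lo n)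
  longest-chain lo n = recast (+-comm n lo)
                         (scan-chain lo lo n ≤-refl)

  longest-max : ∀ lo n {k} → Chain F (lo + n) lo k → k ≤ longest lo n
  longest-max lo n (stop _) = z≤n
  longest-max lo n (link lo≤x x≤y fxy c) = scan-max lo lo n lo≤x x≤y fxy (≤-trans lo≤x x≤y)
    (recast (+-comm lo n) c)

open Greedy public using (longest; longest-chain; longest-max)

longest-mono : ∀ {F G : ℕ → ℕ → Set} (F? : Decidable F) (G? : Decidable G) lo n →
               (∀ {x y} → F x y → G x y) → longest F? lo n ≤ longest G? lo n
longest-mono F? G? lo n f =
  longest-max G? lo n (chain-map (λ _ _ _ → f) (longest-chain F? lo n))

longest-cong : ∀ {F G : ℕ → ℕ → Set} (F? : Decidable F) (G? : Decidable G) lo n →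
               (∀ {x y} → F x y → G x y) → (∀ {x y} → G x y → F x y) →
               longest F? lo n ≡ longest G? lo n
longest-cong F? G? lo n f g = ≤-antisym (longest-mono F? G? lo n f) (longest-mono G? F? lo n g)

-- Summaries of the intervals inside a range

start end : ∀ {n} → Interval n → ℕ
start I = toℕ (left I)
end   I = toℕ (right I)

start≤end : ∀ {n} (I : Interval n) → start I ≤ end I
start≤end (interval l r l≤r) = recompute (toℕ l ≤? toℕ r) l≤r

Span : Set
Span = ℕ × ℕ

Inside : ∀ {n} → Span → Interval n → Set
Inside (lo , hi) I = lo ≤ start I × end I < hi

inside? : ∀ {n} sp (I : Interval n) → Dec (Inside sp I)
inside? (lo , hi) I = (lo ≤? start I) ×-dec (end I <? hi)

-- The least right end and the greatest left end of the intervals inside a span, if any.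
Summary : ℕ → Set
Summary n = Maybe (Fin n × Fin n)

lower : ∀ {n} (i j : Fin n) → Fin n
lower i j with i Fin.≤? j
... | yes _ = i
... | no  _ = j

upper : ∀ {n} (i j : Fin n) → Fin n
upper i j with i Fin.≤? j
... | yes _ = j
... | no  _ = i

extend : ∀ {n} → Interval n → Span → Summary n → Summary n
extend I sp e with inside? sp I | e
... | no  _ | e             = e
... | yes _ | nothing       = just (right I , left I)
... | yes _ | just (ρ , λ′) = just (lower (right I) ρ , upper (left I) λ′)

summary : ∀ {n} → List (Interval n) → Span → Summary n
summary []      sp = nothing
summary (I ∷ X) sp = extend I sp (summary X sp)

-- The extremes come with intervals that attain them, since a window recognised from a summary must
-- be shown to contain an actual interval.
data Summarises {n} (X : List (Interval n)) (sp : Span) : Summary n → Set where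
  none : (∀ {I} → I ∈ X → ¬ Inside sp I) → Summarises X sp nothing
  some : ∀ {I J} → I ∈ X → Inside sp I → J ∈ X → Inside sp J →
         (∀ {K} → K ∈ X → Inside sp K → end I ≤ end K × start K ≤ start J) →
         Summarises X sp (just (right I , left J))

summarises : ∀ {n} (X : List (Interval n)) sp → Summarises X sp (summary X sp)
summarises []      sp = none λ ()
summarises (K ∷ X) sp with inside? sp K | summary X sp | summarises X sp
... | no  K∉ | _ | none ∉ = none λ { (here refl) → K∉ ; (there L∈) → ∉ L∈ }
... | no  K∉ | _ | some I∈ I⊆ J∈ J⊆ best = some (there I∈) I⊆ (there J∈) J⊆
      λ { (here refl) K⊆ → ⊥-elim (K∉ K⊆) ; (there L∈) → best L∈ }
... | yes K⊆ | _ | none ∉ = some (here refl) K⊆ (here refl) K⊆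
      λ { (here refl) _ → ≤-refl , ≤-refl ; (there L∈) L⊆ → ⊥-elim (∉ L∈ L⊆) }
... | yes K⊆ | _ | some {I} {J} I∈ I⊆ J∈ J⊆ best with right K Fin.≤? right I | left K Fin.≤? left J
...   | yes ρ≤ | yes λ≤ = some (here refl) K⊆ (there J∈) J⊆ λ
        { (here refl) _ → ≤-refl , λ≤
        ; (there L∈) L⊆ → let p , q = best L∈ L⊆ in ≤-trans ρ≤ p , q }
...   | yes ρ≤ | no  λ≰ = some (here refl) K⊆ (here refl) K⊆ λ
        { (here refl) _ → ≤-refl , ≤-refl
        ; (there L∈) L⊆ → let p , q = best L∈ L⊆ in ≤-trans ρ≤ p , ≤-trans q (<⇒≤ (≰⇒> λ≰)) }
...   | no  ρ≰ | yes λ≤ = some (there I∈) I⊆ (there J∈) J⊆ λ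
        { (here refl) _ → <⇒≤ (≰⇒> ρ≰) , λ≤ ; (there L∈) L⊆ → best L∈ L⊆ }
...   | no  ρ≰ | no  λ≰ = some (there I∈) I⊆ (here refl) K⊆ λ
        { (here refl) _ → <⇒≤ (≰⇒> ρ≰) , ≤-refl
        ; (there L∈) L⊆ → let p , q = best L∈ L⊆ in p , ≤-trans q (<⇒≤ (≰⇒> λ≰)) }

Contains : ∀ {n} → List (Interval n) → ℕ → ℕ → Set
Contains X x y = ∃[ I ] I ∈ X × x ≤ start I × end I ≤ y

-- A window shares an end with the span it belongs to and contains an interval
-- inside that span, so that it can be recognised from the summary of the span.
Own : ∀ {n} → Summary n → Span → ℕ → ℕ → Set
Own nothing         (lo , hi) x y = ⊥
Own (just (ρ , λ′)) (lo , hi) x y =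
  (x ≡ lo × toℕ ρ ≤ y × y < hi) ⊎ (suc y ≡ hi × lo ≤ x × x ≤ toℕ λ′)

own? : ∀ {n} (e : Summary n) sp → Decidable (Own e sp)
own? nothing         (lo , hi) x y = no λ ()
own? (just (ρ , λ′)) (lo , hi) x y =
  ((x ≟ lo) ×-dec (toℕ ρ ≤? y) ×-dec (y <? hi)) ⊎-dec
  ((suc y ≟ hi) ×-dec (lo ≤? x) ×-dec (x ≤? toℕ λ′))

module _ {n} (X : List (Interval n)) {lo hi : ℕ} where

  own-bounds : ∀ {x y} → Own (summary X (lo , hi)) (lo , hi) x y →
               lo ≤ x × y < hi × Contains X x y
  own-bounds o with summary X (lo , hi) | summarises X (lo , hi)
  own-bounds (inj₁ (refl , ρ≤y , y<hi)) | _ | some {I} I∈ (lo≤I , _) _ _ _ =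
    ≤-refl , y<hi , I , I∈ , lo≤I , ρ≤y
  own-bounds (inj₂ (refl , lo≤x , x≤λ)) | _ | some {J = J} _ _ J∈ (_ , s≤s J≤y) _ =
    lo≤x , ≤-refl , J , J∈ , x≤λ , J≤y

  own-ends : ∀ {x y} → Own (summary X (lo , hi)) (lo , hi) x y → x ≡ lo ⊎ suc y ≡ hi
  own-ends o with summary X (lo , hi)
  own-ends (inj₁ (eq , _)) | just _ = inj₁ eq
  own-ends (inj₂ (eq , _)) | just _ = inj₂ eq

  ownˡ : ∀ {y} → y < hi → Contains X lo y → Own (summary X (lo , hi)) (lo , hi) lo y
  ownˡ y<hi (K , K∈ , lo≤K , K≤y) with summary X (lo , hi) | summarises X (lo , hi)
  ... | _ | none ∉ = ⊥-elim (∉ K∈ (lo≤K , ≤-trans (s≤s K≤y) y<hi))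
  ... | _ | some _ _ _ _ best = let p , _ = best K∈ (lo≤K , ≤-trans (s≤s K≤y) y<hi) in
        inj₁ (refl , ≤-trans p K≤y , y<hi)

  ownʳ : ∀ {x y} → lo ≤ x → suc y ≡ hi → Contains X x y →
         Own (summary X (lo , hi)) (lo , hi) x y
  ownʳ lo≤x refl (K , K∈ , x≤K , K≤y) with summary X (lo , hi) | summarises X (lo , hi)
  ... | _ | none ∉ = ⊥-elim (∉ K∈ (≤-trans lo≤x x≤K , s≤s K≤y))
  ... | _ | some _ _ _ _ best = let _ , q = best K∈ (≤-trans lo≤x x≤K , s≤s K≤y) in
        inj₂ (refl , lo≤x , ≤-trans x≤K q)

-- Windows of a labelled dyadic tree

span : ∀ h → ℕ → Node h → Span
span h       a top     = a , a + 2 ^ h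
span (suc h) a (inˡ u) = span h a u
span (suc h) a (inʳ u) = span h (a + 2 ^ h) u

middle-end : ∀ a h → a + 2 ^ h + 2 ^ h ≡ a + 2 ^ suc h
middle-end a h = lemma a (2 ^ h)
  where
  lemma : ∀ a b → a + b + b ≡ a + 2 * b
  lemma = solve-∀

middle≤end : ∀ a h → a + 2 ^ h ≤ a + 2 ^ suc h
middle≤end a h = +-monoʳ-≤ a (m≤m+n (2 ^ h) _)

middle<end : ∀ a h → a + 2 ^ h < a + 2 ^ suc h
middle<end a h = ≤-trans (m<m+n (a + 2 ^ h) (m^n>0 2 h)) (≤-reflexive (middle-end a h))

module _ {n : ℕ} where

  Label : ℕ → Set
  Label h = Node h → Summary n

  Window : ∀ h → ℕ → Label h → ℕ → ℕ → Set
  Window zero    a e x y = Own (e top) (a , a + 2 ^ 0) x y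
  Window (suc h) a e x y = Own (e top) (a , a + 2 ^ suc h) x y ⊎
    Window h a (e ∘ inˡ) x y ⊎ Window h (a + 2 ^ h) (e ∘ inʳ) x y

  window? : ∀ h a e → Decidable (Window h a e)
  window? zero    a e x y = own? (e top) (a , a + 2 ^ 0) x y
  window? (suc h) a e x y = own? (e top) (a , a + 2 ^ suc h) x y ⊎-dec
    window? h a (e ∘ inˡ) x y ⊎-dec window? h (a + 2 ^ h) (e ∘ inʳ) x y

  window-top : ∀ h a e {x y} → Own (e top) (a , a + 2 ^ h) x y → Window h a e x y
  window-top zero    a e o = o
  window-top (suc h) a e o = inj₁ o

  window-cong : ∀ h a {e e′ : Label h} → (∀ u → e u ≡ e′ u) → ∀ {x y} →
                Window h a e x y → Window h a e′ x y
  window-cong zero    a e≗ {x} {y} w = subst (λ s → Own s (a , a + 2 ^ 0) x y) (e≗ top) w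
  window-cong (suc h) a e≗ {x} {y} (inj₁ w) =
    inj₁ (subst (λ s → Own s (a , a + 2 ^ suc h) x y) (e≗ top) w)
  window-cong (suc h) a e≗ (inj₂ (inj₁ w)) = inj₂ (inj₁ (window-cong h a (e≗ ∘ inˡ) w))
  window-cong (suc h) a e≗ (inj₂ (inj₂ w)) = inj₂ (inj₂ (window-cong h (a + 2 ^ h) (e≗ ∘ inʳ) w))

  gain : ∀ h → ℕ → Label h → ℕ
  gain h a e = longest (window? h a e) a (2 ^ h)

  gain-cong : ∀ h a {e e′ : Label h} → (∀ u → e u ≡ e′ u) → gain h a e ≡ gain h a e′
  gain-cong h a e≗ = longest-cong (window? h a _) (window? h a _) a (2 ^ h)
    (window-cong h a e≗) (window-cong h a (sym ∘ e≗))

  gain-super : ∀ h a (e : Label (suc h)) →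
               gain h a (e ∘ inˡ) + gain h (a + 2 ^ h) (e ∘ inʳ) ≤ gain (suc h) a e
  gain-super h a e = longest-max (window? (suc h) a e) a (2 ^ suc h)
    (chain-map (λ _ _ _ → inj₂ ∘ inj₁) (longest-chain (window? h a (e ∘ inˡ)) a (2 ^ h)) ⌢
     recast (middle-end a h) (chain-map (λ _ _ _ → inj₂ ∘ inj₂)
       (longest-chain (window? h (a + 2 ^ h) (e ∘ inʳ)) (a + 2 ^ h) (2 ^ h))))

  jump : ∀ h → ℕ → Label h → Node h → ℕ
  jump zero    a e top     = gain zero a e
  jump (suc h) a e top     = gain (suc h) a e ∸ (gain h a (e ∘ inˡ) + gain h (a + 2 ^ h) (e ∘ inʳ))
  jump (suc h) a e (inˡ u) = jump h a (e ∘ inˡ) u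
  jump (suc h) a e (inʳ u) = jump h (a + 2 ^ h) (e ∘ inʳ) u

  jump-top-cong : ∀ h a {e e′ : Label h} → (∀ u → e u ≡ e′ u) → jump h a e top ≡ jump h a e′ top
  jump-top-cong zero    a e≗ = gain-cong zero a e≗
  jump-top-cong (suc h) a e≗ = cong₂ _∸_ (gain-cong (suc h) a e≗)
    (cong₂ _+_ (gain-cong h a (e≗ ∘ inˡ)) (gain-cong h (a + 2 ^ h) (e≗ ∘ inʳ)))

  -- The jumps telescope over the tree; by `gain-super` the truncated subtraction in `jump` is
  -- exact.
  ∑-jump : ∀ h a (e : Label h) → ∑ (nodes h) (jump h a e) ≡ gain h a e
  ∑-jump zero    a e = +-identityʳ _
  ∑-jump (suc h) a e = trans (∑-nodes h (jump (suc h) a e))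
    (trans (cong (_+_ (jump (suc h) a e top))
              (cong₂ _+_ (∑-jump h a (e ∘ inˡ)) (∑-jump h (a + 2 ^ h) (e ∘ inʳ))))
           (m∸n+n≡m (gain-super h a e)))

module _ {n} (X : List (Interval n)) where

  label : ∀ h → ℕ → Label h
  label h a u = summary X (span h a u)

  window-bounds : ∀ h a {x y} → Window h a (label h a) x y →
                  a ≤ x × y < a + 2 ^ h × Contains X x y
  window-bounds zero    a w = own-bounds X w
  window-bounds (suc h) a (inj₁ w) = own-bounds X w
  window-bounds (suc h) a (inj₂ (inj₁ w)) = let p , q , r = window-bounds h a w in
    p , ≤-trans q (middle≤end a h) , r
  window-bounds (suc h) a (inj₂ (inj₂ w)) = let p , q , r = window-bounds h (a + 2 ^ h) w in
    ≤-trans (m≤m+n a _) p , ≤-trans q (≤-reflexive (middle-end a h)) , r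

  -- A window owned by the block that ends before the middle must share the left end of the block,
  -- which is also the left end of its left half; the interval it contains lies in that half.
  window-leftHalf : ∀ h a {x y} → x ≤ y → y < a + 2 ^ h →
                    Window (suc h) a (label (suc h) a) x y → Window h a (label h a) x y
  window-leftHalf h a x≤y y<mid (inj₁ o) with own-ends X o | own-bounds X o
  ... | inj₁ refl | _ , _ , c = window-top h a (label h a) (ownˡ X y<mid c)
  ... | inj₂ eq   | _         =
    ⊥-elim (<⇒≱ (middle<end a h) (≤-trans (≤-reflexive (sym eq)) y<mid))
  window-leftHalf h a x≤y y<mid (inj₂ (inj₁ w)) = w
  window-leftHalf h a x≤y y<mid (inj₂ (inj₂ w)) =
    ⊥-elim (<⇒≱ y<mid (≤-trans (proj₁ (window-bounds h (a + 2 ^ h) w)) x≤y))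

  window-rightHalf : ∀ h a {x y} → a + 2 ^ h ≤ x → x ≤ y → Window (suc h) a (label (suc h) a) x y →
                     Window h (a + 2 ^ h) (label h (a + 2 ^ h)) x y
  window-rightHalf h a mid≤x x≤y (inj₁ o) with own-ends X o | own-bounds X o
  ... | inj₁ refl | _         = ⊥-elim (<⇒≱ (m<m+n a (m^n>0 2 h)) mid≤x)
  ... | inj₂ eq   | _ , _ , c = window-top h (a + 2 ^ h) (label h (a + 2 ^ h))
                                  (ownʳ X mid≤x (trans eq (sym (middle-end a h))) c)
  window-rightHalf h a mid≤x x≤y (inj₂ (inj₁ w)) =
    ⊥-elim (<⇒≱ (proj₁ (proj₂ (window-bounds h a w))) (≤-trans mid≤x x≤y))
  window-rightHalf h a mid≤x x≤y (inj₂ (inj₂ w)) = w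

  gain-sub : ∀ h a → gain (suc h) a (label (suc h) a) ≤
                     suc (gain h a (label h a) + gain h (a + 2 ^ h) (label h (a + 2 ^ h)))
  gain-sub h a =
    let k , l , c₁ , c₂ , ≤kl = chain-split (a + 2 ^ h) (m≤m+n a _) (middle≤end a h)
                                  (longest-chain (window? (suc h) a (label (suc h) a)) a (2 ^ suc h))
    in ≤-trans ≤kl (s≤s (+-mono-≤
         (longest-max (window? h a _) a (2 ^ h)
           (chain-map (λ _ x≤y y<mid → window-leftHalf h a x≤y y<mid) c₁))
         (longest-max (window? h (a + 2 ^ h) _) (a + 2 ^ h) (2 ^ h)
           (recast (sym (middle-end a h))
             (chain-map (λ mid≤x x≤y _ → window-rightHalf h a mid≤x x≤y) c₂)))))

  gain≤2^ : ∀ h a → gain h a (label h a) ≤ 2 ^ h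
  gain≤2^ h a = +-cancelˡ-≤ a _ _ (chain-length (longest-chain (window? h a (label h a)) a (2 ^ h)))

  jump≤1 : ∀ h a u → jump h a (label h a) u ≤ 1
  jump≤1 zero    a top     = gain≤2^ 0 a
  jump≤1 (suc h) a top     = ≤-trans (∸-monoˡ-≤ s (gain-sub h a)) (≤-reflexive (m+n∸n≡m 1 s))
    where s = gain h a (label h a) + gain h (a + 2 ^ h) (label h (a + 2 ^ h))
  jump≤1 (suc h) a (inˡ u) = jump≤1 h a u
  jump≤1 (suc h) a (inʳ u) = jump≤1 h (a + 2 ^ h) u

  active : ∀ h a → Node h → ℕ
  active h a u = ⟦ is-just (label h a u) ⟧

  active≤gain : ∀ h a → active h a top ≤ gain h a (label h a)
  active≤gain h a = go (summary X (a , a + 2 ^ h)) (summarises X (a , a + 2 ^ h))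
    where
    go : ∀ s → Summarises X (a , a + 2 ^ h) s → ⟦ is-just s ⟧ ≤ gain h a (label h a)
    go _ (none _) = z≤n
    go _ (some {I} I∈ (a≤I , I<hi) _ _ _) = longest-max (window? h a (label h a)) a (2 ^ h)
      (link ≤-refl (≤-trans a≤I (start≤end I))
            (window-top h a (label h a) (ownˡ X I<hi (I , I∈ , a≤I , ≤-refl))) (stop I<hi))

  -- Every nonempty block has gain at least 1, and by superadditivity the gains of the blocks of one
  -- depth add up to at most the gain of the root. There are 1 + `h` depths.
  ∑-active : ∀ h a → ∑ (nodes h) (active h a) ≤ suc h * gain h a (label h a)
  ∑-active zero    a = +-monoˡ-≤ 0 (active≤gain 0 a)
  ∑-active (suc h) a = begin
    ∑ (nodes (suc h)) (active (suc h) a)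
      ≡⟨ ∑-nodes h (active (suc h) a) ⟩
    active (suc h) a top + (∑ (nodes h) (active h a) + ∑ (nodes h) (active h (a + 2 ^ h)))
      ≤⟨ +-mono-≤ (active≤gain (suc h) a) (+-mono-≤ (∑-active h a) (∑-active h (a + 2 ^ h))) ⟩
    G + (suc h * Gˡ + suc h * Gʳ)
      ≡⟨ cong (_+_ G) (sym (*-distribˡ-+ (suc h) Gˡ Gʳ)) ⟩
    G + suc h * (Gˡ + Gʳ)
      ≤⟨ +-monoʳ-≤ G (*-monoʳ-≤ (suc h) (gain-super h a (label (suc h) a))) ⟩
    G + suc h * G ∎
    where
    open ≤-Reasoning
    G Gˡ Gʳ : ℕ
    G  = gain (suc h) a (label (suc h) a)
    Gˡ = gain h a (label h a)
    Gʳ = gain h (a + 2 ^ h) (label h (a + 2 ^ h))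

  widen : ∀ {x x′ y y′} → x′ ≤ x → y ≤ y′ → Contains X x y → Contains X x′ y′
  widen ≤x y≤ (I , I∈ , x≤I , I≤y) = I , I∈ , ≤-trans ≤x x≤I , ≤-trans I≤y y≤

  -- The dyadic cut that separates two disjoint intervals bounds a window
  -- inside their hull.
  hull-window : ∀ h a {x₁ y₁ x₂ y₂} → a ≤ x₁ → x₁ ≤ y₁ → y₁ < x₂ → x₂ ≤ y₂ → y₂ < a + 2 ^ h →
                Contains X x₁ y₁ → Contains X x₂ y₂ →
                ∃[ x ] ∃[ y ] x₁ ≤ x × x ≤ y × y ≤ y₂ × Window h a (label h a) x y
  hull-window zero a a≤x₁ x₁≤y₁ y₁<x₂ x₂≤y₂ y₂<hi _ _ =
    ⊥-elim (<⇒≱ (≤-trans (s≤s (≤-trans a≤x₁ x₁≤y₁)) (≤-trans y₁<x₂ x₂≤y₂))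
      (m<1+n⇒m≤n (≤-trans y₂<hi (≤-reflexive (+-comm a 1)))))
  hull-window (suc h) a {x₁} {y₁} {x₂} {y₂} a≤x₁ x₁≤y₁ y₁<x₂ x₂≤y₂ y₂<hi c₁ c₂
    with a + 2 ^ h ≤? x₂ | a + 2 ^ h ≤? x₁ | a + 2 ^ h ≤? y₂
  ... | yes mid≤x₂ | yes mid≤x₁ | _ =
    let x , y , p , q , r , w = hull-window h (a + 2 ^ h) mid≤x₁ x₁≤y₁ y₁<x₂ x₂≤y₂
                                  (≤-trans y₂<hi (≤-reflexive (sym (middle-end a h)))) c₁ c₂
    in x , y , p , q , r , inj₂ (inj₂ w)
  -- The middle lies in (x₁ , x₂]: the window from the middle to `y₂` contains the second interval
  -- and shares the left end of the right half.
  ... | yes mid≤x₂ | no  mid≰x₁ | _ =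
    a + 2 ^ h , y₂ , <⇒≤ (≰⇒> mid≰x₁) , ≤-trans mid≤x₂ x₂≤y₂ , ≤-refl ,
    inj₂ (inj₂ (window-top h (a + 2 ^ h) (label h (a + 2 ^ h))
      (ownˡ X (≤-trans y₂<hi (≤-reflexive (sym (middle-end a h)))) (widen mid≤x₂ ≤-refl c₂))))
  ... | no  mid≰x₂ | _ | no  mid≰y₂ =
    let x , y , p , q , r , w = hull-window h a a≤x₁ x₁≤y₁ y₁<x₂ x₂≤y₂ (≰⇒> mid≰y₂) c₁ c₂
    in x , y , p , q , r , inj₂ (inj₁ w)
  -- The middle lies in (x₂ , y₂]: the window from `x₁` to just before the middle contains the first
  -- interval and shares the right end of the left half.
  ... | no  mid≰x₂ | _ | yes mid≤y₂ = cut (a + 2 ^ h) refl (≰⇒> mid≰x₂) mid≤y₂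
    where
    cut : ∀ mid → mid ≡ a + 2 ^ h → x₂ < mid → mid ≤ y₂ →
          ∃[ x ] ∃[ y ] x₁ ≤ x × x ≤ y × y ≤ y₂ × Window (suc h) a (label (suc h) a) x y
    cut (suc y) eq (s≤s x₂≤y) y<y₂ =
      x₁ , y , ≤-refl , ≤-trans x₁≤y₁ (≤-trans (<⇒≤ y₁<x₂) x₂≤y) , <⇒≤ y<y₂ ,
      inj₂ (inj₁ (window-top h a (label h a)
        (ownʳ X a≤x₁ eq (widen ≤-refl (≤-trans (<⇒≤ y₁<x₂) x₂≤y) c₁))))

  pair-up : ∀ h a {lo k} → a ≤ lo → Chain (Contains X) (a + 2 ^ h) lo k →
            ∃[ m ] Chain (Window h a (label h a)) (a + 2 ^ h) lo m × k ≤ suc (2 * m)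
  pair-up h a a≤lo (stop lo≤hi) = 0 , stop lo≤hi , z≤n
  pair-up h a a≤lo (link lo≤x x≤y _ (stop y<hi)) =
    0 , stop (≤-trans (≤-trans lo≤x x≤y) (<⇒≤ y<hi)) , ≤-refl
  pair-up h a a≤lo (link lo≤x₁ x₁≤y₁ c₁ (link y₁<x₂ x₂≤y₂ c₂ c)) =
    let a≤x₁ = ≤-trans a≤lo lo≤x₁
        x , y , x₁≤x , x≤y , y≤y₂ , w = hull-window h a a≤x₁ x₁≤y₁ y₁<x₂ x₂≤y₂ (chain-bounds c) c₁ c₂
        m , c′ , k≤ = pair-up h a (≤-trans (≤-trans a≤x₁ x₁≤y₁)
                                     (≤-trans (<⇒≤ y₁<x₂) (≤-trans x₂≤y₂ (n≤1+n _)))) c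
    in suc m , link (≤-trans lo≤x₁ x₁≤x) x≤y w (weakenˡ (s≤s y≤y₂) c′) ,
       ≤-trans (s≤s (s≤s k≤)) (≤-reflexive (lemma m))
    where
    lemma : ∀ m → 2 + (1 + 2 * m) ≡ 1 + 2 * (1 + m)
    lemma = solve-∀

  -- Pairing up everything could leave one interval unmatched. Instead the first one is stretched to
  -- the left end `a`, which makes it a window of the root by itself; the others yield `m` windows
  -- with k - 1 ≤ 2m + 1, so k ≤ 2(m + 1).
  chain≤2gain : ∀ h a {k} → Chain (Contains X) (a + 2 ^ h) a k → k ≤ 2 * gain h a (label h a)
  chain≤2gain h a (stop _) = z≤n
  chain≤2gain h a (link {y = y} a≤x x≤y c₁ c) =
    let m , c′ , k≤ = pair-up h a (≤-trans a≤x (≤-trans x≤y (n≤1+n y))) c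
        w = window-top h a (label h a) (ownˡ X (chain-bounds c) (widen a≤x ≤-refl c₁))
    in ≤-trans (s≤s k≤) (≤-trans (≤-reflexive (lemma m))
         (*-monoʳ-≤ 2 (longest-max (window? h a (label h a)) a (2 ^ h)
           (link ≤-refl (≤-trans a≤x x≤y) w c′))))
    where
    lemma : ∀ m → 2 + 2 * m ≡ 2 * (1 + m)
    lemma = solve-∀

  gain-chain : ∀ h a → Chain (Contains X) (a + 2 ^ h) a (gain h a (label h a))
  gain-chain h a = chain-map (λ _ _ _ w → proj₂ (proj₂ (window-bounds h a w)))
                     (longest-chain (window? h a (label h a)) a (2 ^ h))

-- Subtrees of sampled nodes

below : ∀ {h} → (Node h → ℕ) → Node h → ℕ
below {h} f top     = ∑ (nodes h) f
below     f (inˡ u) = below (f ∘ inˡ) u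
below     f (inʳ u) = below (f ∘ inʳ) u

-- Double counting: the value at a node is counted once for each of its at most 1 + `h` ancestors,
-- itself included.
∑-below : ∀ h (f : Node h → ℕ) → ∑ (nodes h) (below f) ≤ suc h * ∑ (nodes h) f
∑-below zero    f = ≤-refl
∑-below (suc h) f = begin
  ∑ (nodes (suc h)) (below f)
    ≡⟨ ∑-nodes h (below f) ⟩
  ∑ (nodes (suc h)) f + (∑ (nodes h) (below (f ∘ inˡ)) + ∑ (nodes h) (below (f ∘ inʳ)))
    ≤⟨ +-monoʳ-≤ (∑ (nodes (suc h)) f) (+-mono-≤ (∑-below h (f ∘ inˡ)) (∑-below h (f ∘ inʳ))) ⟩
  ∑ (nodes (suc h)) f + (suc h * ∑ (nodes h) (f ∘ inˡ) + suc h * ∑ (nodes h) (f ∘ inʳ))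
    ≡⟨ cong (_+_ (∑ (nodes (suc h)) f)) (sym (*-distribˡ-+ (suc h) (∑ (nodes h) (f ∘ inˡ)) _)) ⟩
  ∑ (nodes (suc h)) f + suc h * (∑ (nodes h) (f ∘ inˡ) + ∑ (nodes h) (f ∘ inʳ))
    ≤⟨ +-monoʳ-≤ (∑ (nodes (suc h)) f) (*-monoʳ-≤ (suc h)
         (≤-trans (m≤n+m _ (f top)) (≤-reflexive (sym (∑-nodes h f))))) ⟩
  ∑ (nodes (suc h)) f + suc h * ∑ (nodes (suc h)) f ∎
  where open ≤-Reasoning

-- The nodes with an ancestor in `S`, themselves included; for the sample `S` these are the blocks
-- whose summaries are stored.
covered : ∀ {h} → (Node h → Bool) → Node h → Bool
covered S top     = S top
covered S (inˡ u) = S top ∨ covered (S ∘ inˡ) u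
covered S (inʳ u) = S top ∨ covered (S ∘ inʳ) u

-- On the right a covered node is counted once for each ancestor in `S`, hence at least once. The
-- right side is linear in the indicators of `S`, so its expectation is easy.
∑-covered : ∀ h (S : Node h → Bool) f →
  ∑ (nodes h) (λ u → ⟦ covered S u ⟧ * f u) ≤ ∑ (nodes h) (λ u → ⟦ S u ⟧ * below f u)
∑-covered zero    S f = ≤-reflexive (cong (λ k → ⟦ S top ⟧ * k + 0) (sym (+-identityʳ (f top))))
∑-covered (suc h) S f = by-root (S top) refl
  where
  open ≤-Reasoning
  R : ℕ
  R = ∑ (nodes h) (λ u → ⟦ S (inˡ u) ⟧ * below f (inˡ u)) +
      ∑ (nodes h) (λ u → ⟦ S (inʳ u) ⟧ * below f (inʳ u))
  by-root : ∀ b → S top ≡ b → ∑ (nodes (suc h)) (λ u → ⟦ covered S u ⟧ * f u) ≤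
                              ∑ (nodes (suc h)) (λ u → ⟦ S u ⟧ * below f u)
  -- Once the root is in `S`, its term alone dominates the sum over all nodes.
  by-root true  eq = begin
    ∑ (nodes (suc h)) (λ u → ⟦ covered S u ⟧ * f u)
      ≤⟨ ∑-mono (nodes (suc h)) (λ u → ≤-trans (*-monoˡ-≤ (f u) (⟦⟧≤1 (covered S u)))
                                               (≤-reflexive (*-identityˡ (f u)))) ⟩
    ∑ (nodes (suc h)) f
      ≡⟨ sym (trans (cong (λ b → ⟦ b ⟧ * below f top) eq) (*-identityˡ (below f top))) ⟩
    ⟦ S top ⟧ * below f top
      ≤⟨ m≤m+n (⟦ S top ⟧ * below f top) R ⟩
    ⟦ S top ⟧ * below f top + R
      ≡⟨ sym (∑-nodes h (λ u → ⟦ S u ⟧ * below f u)) ⟩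
    ∑ (nodes (suc h)) (λ u → ⟦ S u ⟧ * below f u) ∎
  by-root false eq = begin
    ∑ (nodes (suc h)) (λ u → ⟦ covered S u ⟧ * f u)
      ≡⟨ ∑-nodes h _ ⟩
    ⟦ S top ⟧ * f top + (∑ (nodes h) (λ u → ⟦ covered S (inˡ u) ⟧ * f (inˡ u)) +
                         ∑ (nodes h) (λ u → ⟦ covered S (inʳ u) ⟧ * f (inʳ u)))
      ≡⟨ cong (λ b → ⟦ b ⟧ * f top +
           (∑ (nodes h) (λ u → ⟦ b ∨ covered (S ∘ inˡ) u ⟧ * f (inˡ u)) +
            ∑ (nodes h) (λ u → ⟦ b ∨ covered (S ∘ inʳ) u ⟧ * f (inʳ u)))) eq ⟩
    ∑ (nodes h) (λ u → ⟦ covered (S ∘ inˡ) u ⟧ * f (inˡ u)) +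
    ∑ (nodes h) (λ u → ⟦ covered (S ∘ inʳ) u ⟧ * f (inʳ u))
      ≤⟨ +-mono-≤ (∑-covered h (S ∘ inˡ) (f ∘ inˡ)) (∑-covered h (S ∘ inʳ) (f ∘ inʳ)) ⟩
    R
      ≤⟨ m≤n+m R (⟦ S top ⟧ * below f top) ⟩
    ⟦ S top ⟧ * below f top + R
      ≡⟨ sym (∑-nodes h (λ u → ⟦ S u ⟧ * below f u)) ⟩
    ∑ (nodes (suc h)) (λ u → ⟦ S u ⟧ * below f u) ∎

∨-trueʳ : ∀ a {b} → b ≡ true → a ∨ b ≡ true
∨-trueʳ true  _ = refl
∨-trueʳ false p = p

covered-all : ∀ {h} (S : Node h → Bool) → S top ≡ true → ∀ u → covered S u ≡ true
covered-all S eq top     = eq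
covered-all S eq (inˡ u) = cong (_∨ covered (S ∘ inˡ) u) eq
covered-all S eq (inʳ u) = cong (_∨ covered (S ∘ inʳ) u) eq

-- The jump at `u` only involves labels in the subtree of `u`, and this subtree is covered when `u`
-- is in `S`.
jump-cong : ∀ {n} h a {e e′ : Label {n} h} (S : Node h → Bool) →
            (∀ u → covered S u ≡ true → e u ≡ e′ u) →
            ∀ u → S u ≡ true → jump h a e u ≡ jump h a e′ u
jump-cong h       a S e≗ top     eq = jump-top-cong h a (λ u → e≗ u (covered-all S eq u))
jump-cong (suc h) a S e≗ (inˡ u) eq =
  jump-cong h a (S ∘ inˡ) (λ v p → e≗ (inˡ v) (∨-trueʳ (S top) p)) u eq
jump-cong (suc h) a S e≗ (inʳ u) eq =
  jump-cong h (a + 2 ^ h) (S ∘ inʳ) (λ v p → e≗ (inʳ v) (∨-trueʳ (S top) p)) u eq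

∈-nodes : ∀ {h} (u : Node h) → u ∈ nodes h
∈-nodes {zero}  top     = here refl
∈-nodes {suc h} top     = here refl
∈-nodes {suc h} (inˡ u) = there (∈-++⁺ˡ (∈-map⁺ inˡ (∈-nodes u)))
∈-nodes {suc h} (inʳ u) = there (∈-++⁺ʳ (map inˡ (nodes h)) (∈-map⁺ inʳ (∈-nodes u)))

-- Finite tables of labels

module _ {K V : Set} where

  entry : Bool → K → Maybe V → List (K × V) → List (K × V)
  entry true  u (just s) es = (u , s) ∷ es
  entry true  u nothing  es = es
  entry false u _        es = es

  collect : (K → Bool) → (K → Maybe V) → List K → List (K × V)
  collect C e []       = []
  collect C e (u ∷ us) = entry (C u) u (e u) (collect C e us)

  length-collect : ∀ C e us → length (collect C e us) ≡ ∑ us (λ u → ⟦ C u ⟧ * ⟦ is-just (e u) ⟧)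
  length-collect C e []       = refl
  length-collect C e (u ∷ us) with C u | e u
  ... | true  | just _  = cong suc (length-collect C e us)
  ... | true  | nothing = length-collect C e us
  ... | false | just _  = length-collect C e us
  ... | false | nothing = length-collect C e us

  collect-cong : ∀ C {e e′} us → (∀ u → C u ≡ true → e u ≡ e′ u) →
                 collect C e us ≡ collect C e′ us
  collect-cong C []       e≗ = refl
  collect-cong C {e} {e′} (u ∷ us) e≗ rewrite collect-cong C us e≗ with C u in eq
  ... | true  = cong (λ s → entry true u s (collect C e′ us)) (e≗ u eq)
  ... | false = refl

  module Lookup (_≟ᴷ_ : ∀ (u v : K) → Dec (u ≡ v)) where

    find : List (K × V) → K → Maybe V
    find []             u = nothing
    find ((v , s) ∷ es) u = if does (u ≟ᴷ v) then just s else find es u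

    find-collect-nothing : ∀ C e us {u} → e u ≡ nothing → find (collect C e us) u ≡ nothing
    find-collect-nothing C e []       eq = refl
    find-collect-nothing C e (v ∷ us) {u} eq with C v | e v in ev
    ... | false | _       = find-collect-nothing C e us eq
    ... | true  | nothing = find-collect-nothing C e us eq
    ... | true  | just _  with u ≟ᴷ v
    ...   | yes refl = case trans (sym eq) ev of λ ()
    ...   | no  _    = find-collect-nothing C e us eq

    find-collect-just : ∀ C e us {u s} → u ∈ us → C u ≡ true → e u ≡ just s →
                        find (collect C e us) u ≡ just s
    find-collect-just C e (v ∷ us) {u} u∈ cu eq with C v in cv | e v in ev
    find-collect-just C e (v ∷ us) {u} (here refl) cu eq | true | just t with u ≟ᴷ u
    ... | yes _   = trans (sym ev) eq
    ... | no  u≢u = ⊥-elim (u≢u refl)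
    find-collect-just C e (v ∷ us) {u} (there u∈) cu eq | true | just t with u ≟ᴷ v
    ... | yes refl = trans (sym ev) eq
    ... | no  _    = find-collect-just C e us u∈ cu eq
    find-collect-just C e (v ∷ us) (here refl) cu eq | true  | nothing = case trans (sym ev) eq of λ ()
    find-collect-just C e (v ∷ us) (there u∈)  cu eq | true  | nothing = find-collect-just C e us u∈ cu eq
    find-collect-just C e (v ∷ us) (here refl) cu eq | false | _       = case trans (sym cv) cu of λ ()
    find-collect-just C e (v ∷ us) (there u∈)  cu eq | false | _       = find-collect-just C e us u∈ cu eq

    -- Empty labels occupy no entry, yet a failed search reads them back correctly. Thus only
    -- nonempty blocks count towards the size of a table.
    find-collect : ∀ C e us {u} → u ∈ us → C u ≡ true → find (collect C e us) u ≡ e u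
    find-collect C e us {u} u∈ cu with e u in eq
    ... | just s  = find-collect-just C e us u∈ cu eq
    ... | nothing = find-collect-nothing C e us eq

module _ {A : Set} where

  pad : ∀ k → List A → Vec (Maybe A) k
  pad zero    xs       = []
  pad (suc k) []       = nothing ∷ pad k []
  pad (suc k) (x ∷ xs) = just x ∷ pad k xs

  unpad : ∀ {k} → Vec (Maybe A) k → List A
  unpad []            = []
  unpad (nothing ∷ v) = unpad v
  unpad (just x ∷ v)  = x ∷ unpad v

  unpad-pad : ∀ k xs → length xs ≤ k → unpad (pad k xs) ≡ xs
  unpad-pad zero    []       _         = refl
  unpad-pad (suc k) []       _         = unpad-pad k [] z≤n
  unpad-pad (suc k) (x ∷ xs) (s≤s len) = cong (x ∷_) (unpad-pad k xs len)

  Store : ℕ → Set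
  Store k = Maybe (Vec (Maybe A) k)

  store : ∀ k → List A → Store k
  store k xs with length xs ≤? k
  ... | yes _ = just (pad k xs)
  ... | no  _ = nothing

  store-nothing : ∀ k xs → k < length xs → store k xs ≡ nothing
  store-nothing k xs len with length xs ≤? k
  ... | yes len′ = ⊥-elim (<⇒≱ len len′)
  ... | no  _   = refl

-- The streaming sketch

module Sketch (n h m M : ℕ) where

  open Lookup {Node h} {Fin n × Fin n} _≟ᴺ_

  Entry Level : Set
  Entry = Node h × (Fin n × Fin n)
  Level = Store {Entry} M

  table : ℕ → Seed (h * 2) m → Label {n} h → List Entry
  table j s e = collect (covered (kept j s)) e (nodes h)

  size : List (Interval n) → ℕ → Seed (h * 2) m → ℕ
  size X j s = length (table j s (label X h 0))

  size≤ : ∀ X j s → size X j s ≤ ∑ (nodes h) (λ u → ⟦ kept j s u ⟧ * below (active X h 0) u)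
  size≤ X j s = ≤-trans (≤-reflexive (length-collect (covered (kept j s)) (label X h 0) (nodes h)))
                        (∑-covered h (kept j s) (active X h 0))

  level : ℕ → Seed (h * 2) m → List (Interval n) → Level
  level j s X = store M (table j s (label X h 0))

  advance : ℕ → Seed (h * 2) m → Interval n → Level → Level
  advance j s I nothing  = nothing
  advance j s I (just v) = store M (table j s (λ u → extend I (span h 0 u) (find (unpad v) u)))

  private
    extend-just : ∀ I sp (e : Summary n) → ⟦ is-just e ⟧ ≤ ⟦ is-just (extend I sp e) ⟧
    extend-just I sp nothing  = z≤n
    extend-just I sp (just _) with inside? sp I
    ... | yes _ = ≤-refl
    ... | no  _ = ≤-refl

  size-mono : ∀ I X j s → size X j s ≤ size (I ∷ X) j s
  size-mono I X j s = begin
    size X j s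
      ≡⟨ length-collect C (label X h 0) (nodes h) ⟩
    ∑ (nodes h) (λ u → ⟦ C u ⟧ * ⟦ is-just (label X h 0 u) ⟧)
      ≤⟨ ∑-mono (nodes h) (λ u → *-monoʳ-≤ ⟦ C u ⟧ (extend-just I (span h 0 u) (label X h 0 u))) ⟩
    ∑ (nodes h) (λ u → ⟦ C u ⟧ * ⟦ is-just (label (I ∷ X) h 0 u) ⟧)
      ≡⟨ sym (length-collect C (label (I ∷ X) h 0) (nodes h)) ⟩
    size (I ∷ X) j s ∎
    where
    open ≤-Reasoning
    C : Node h → Bool
    C = covered (kept j s)

  find-table : ∀ j s e → length (table j s e) ≤ M → ∀ u → covered (kept j s) u ≡ true →
               find (unpad (pad M (table j s e))) u ≡ e u
  find-table j s e len u cu = trans (cong (λ es → find es u) (unpad-pad M (table j s e) len))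
    (find-collect (covered (kept j s)) e (nodes h) (∈-nodes u) cu)

  -- The stored level is a function of the seed and the intervals read so far: covered labels are
  -- read back exactly, and an overflow is permanent because tables only grow.
  advance-level : ∀ j s I X → advance j s I (level j s X) ≡ level j s (I ∷ X)
  advance-level j s I X with length (table j s (label X h 0)) ≤? M
  ... | yes len = cong (store M) (collect-cong (covered (kept j s)) (nodes h)
          (λ u cu → cong (extend I (span h 0 u)) (find-table j s (label X h 0) len u cu)))
  ... | no ¬len = sym (store-nothing M (table j s (label (I ∷ X) h 0))
          (≤-trans (≰⇒> ¬len) (size-mono I X j s)))

  levels : ∀ k l → Seed (h * 2) m → List (Interval n) → Vec Level l
  levels k zero    s X = []
  levels k (suc l) s X = level k s X ∷ levels (suc k) l s X

  advances : ∀ k {l} → Seed (h * 2) m → Interval n → Vec Level l → Vec Level l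
  advances k s I []       = []
  advances k s I (L ∷ Ls) = advance k s I L ∷ advances (suc k) s I Ls

  advances-levels : ∀ k l s I X → advances k s I (levels k l s X) ≡ levels k l s (I ∷ X)
  advances-levels k zero    s I X = refl
  advances-levels k (suc l) s I X = cong₂ _∷_ (advance-level k s I X) (advances-levels (suc k) l s I X)

  -- The lowest surviving level has the highest sampling rate. The value 0 stands for the case that
  -- every table has overflowed.
  answer : ∀ k {l} → Seed (h * 2) m → Vec Level l → ℕ
  answer k s []             = 0
  answer k s (nothing ∷ Ls) = answer (suc k) s Ls
  answer k s (just v  ∷ Ls) = estimate k s (jump h 0 (find (unpad v)))

  read-level : ∀ k s X → size X k s ≤ M →
    estimate k s (jump h 0 (find (unpad (pad M (table k s (label X h 0)))))) ≡
    estimate k s (jump h 0 (label X h 0))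
  read-level k s X len = cong (2 ^ k *_) (∑-cong (nodes h) pointwise)
    where
    pointwise : ∀ u → ⟦ kept k s u ⟧ * jump h 0 (find (unpad (pad M (table k s (label X h 0))))) u ≡
                      ⟦ kept k s u ⟧ * jump h 0 (label X h 0) u
    pointwise u with kept k s u in eq
    ... | false = refl
    ... | true  = cong (1 *_) (jump-cong h 0 (kept k s) (find-table k s (label X h 0) len) u eq)

  answer-levels : ∀ k l s X {j} → k ≤ j → j < k + l → size X j s ≤ M →
    ∃[ i ] i ≤ j × answer k s (levels k l s X) ≡ estimate i s (jump h 0 (label X h 0))
  answer-levels k zero    s X k≤j j< len = ⊥-elim (<⇒≱ j< (≤-trans (≤-reflexive (+-identityʳ k)) k≤j))
  answer-levels k (suc l) s X k≤j j< len with size X k s ≤? M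
  ... | yes len′ = k , k≤j , read-level k s X len′
  ... | no ¬len′ with m≤n⇒m<n∨m≡n k≤j
  ...   | inj₁ k<j  = answer-levels (suc k) l s X k<j (≤-trans j< (≤-reflexive (+-suc k l))) len
  ...   | inj₂ refl = ⊥-elim (¬len′ len)

-- Codes of memory contents

record Code (n : ℕ) (A : Set) (k : ℕ) : Set where
  field
    encode        : A → Vec (Fin n) k
    decode       : Vec (Fin n) k → A
    decode-encode : ∀ a → decode (encode a) ≡ a

open Code

module _ {n : ℕ} where

  code-retract : ∀ {A B k} (f : A → B) (g : B → A) → (∀ a → g (f a) ≡ a) → Code n B k → Code n A k
  code-retract f g gf c = record
    { encode        = encode c ∘ f
    ; decode       = g ∘ decode c
    ; decode-encode = λ a → trans (cong g (decode-encode c (f a))) (gf a)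
    }

  code-fin : Code n (Fin n) 1
  code-fin = record
    { encode        = λ i → i ∷ []
    ; decode       = λ { (i ∷ []) → i }
    ; decode-encode = λ _ → refl
    }

  code-× : ∀ {A B k l} → Code n A k → Code n B l → Code n (A × B) (k + l)
  code-× {k = k} {l} c c′ = record
    { encode        = λ (a , b) → encode c a Vec.++ encode c′ b
    ; decode       = λ v → decode c (Vec.take k v) , decode c′ (Vec.drop k v)
    ; decode-encode = λ (a , b) →
        let _ , _ , eq = Vec.splitAt k (encode c a Vec.++ encode c′ b)
            eq₁ , eq₂  = Vec.++-injective (encode c a) _ eq
        in cong₂ _,_ (trans (cong (decode c) (sym eq₁)) (decode-encode c a))
                     (trans (cong (decode c′) (sym eq₂)) (decode-encode c′ b))
    }

  code-vec : ∀ {A k} l → Code n A k → Code n (Vec A l) (l * k)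
  code-vec zero    c = record
    { encode = λ _ → [] ; decode = λ _ → [] ; decode-encode = λ { [] → refl } }
  code-vec (suc l) c = code-retract Vec.uncons (λ (a , v) → a ∷ v) (λ { (a ∷ v) → refl })
                         (code-× c (code-vec l c))

module _ {n : ℕ} where

  -- A unit needs two distinct values to hold a bit, whence 2 + `n`. Spending a whole unit on a bit
  -- costs a node 2h units.
  code-bool : Code (2 + n) Bool 1
  code-bool = record
    { encode        = λ { false → Fin.zero ∷ [] ; true → Fin.suc Fin.zero ∷ [] }
    ; decode       = λ { (Fin.zero ∷ []) → false ; (Fin.suc _ ∷ []) → true }
    ; decode-encode = λ { false → refl ; true → refl }
    }

  code-maybe : ∀ {A k} → Code (2 + n) A k → Code (2 + n) (Maybe A) (1 + k)
  code-maybe {k = k} c = record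
    { encode        = λ { nothing → Fin.zero ∷ Vec.replicate k Fin.zero
                        ; (just a) → Fin.suc Fin.zero ∷ encode c a }
    ; decode       = λ { (Fin.zero ∷ _) → nothing ; (Fin.suc _ ∷ v) → just (decode c v) }
    ; decode-encode = λ { nothing → refl ; (just a) → cong just (decode-encode c a) }
    }

  code-node : ∀ h → Code (2 + n) (Node h) (h * 2 * 1)
  code-node h = code-retract code fromCode fromCode-code (code-vec (h * 2) code-bool)

module Streaming (n h M : ℕ) where

  open Sketch (2 + n) h h M public

  State : Set
  State = Seed (h * 2) h × Vec Level (suc h)

  units : ℕ
  units = h * (suc (h * 2) * 1) + suc h * (1 + M * (1 + (h * 2 * 1 + 2)))

  code-state : Code (2 + n) State units
  code-state = code-× (code-vec h (code-vec (suc (h * 2)) code-bool))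
    (code-vec (suc h) (code-maybe (code-vec M (code-maybe
      (code-× (code-node h) (code-× code-fin code-fin))))))

  state : Seed (h * 2) h → List (Interval (2 + n)) → State
  state s X = s , levels 0 (suc h) s X

-- Independent sets and chains

unique-⊆-length : ∀ {A : Set} {xs ys : List A} → Unique xs → All (_∈ ys) xs → length xs ≤ length ys
unique-⊆-length []          []           = z≤n
unique-⊆-length {xs = x ∷ xs} (x∉ ∷ xs!) (x∈ ∷ xs⊆) with as , bs , refl ← ∈-∃++ x∈ = begin
  suc (length xs)             ≤⟨ s≤s (unique-⊆-length xs! (All.zipWith move (x∉ , xs⊆))) ⟩
  suc (length (as ++ bs))     ≡⟨ cong suc (length-++ as) ⟩
  suc (length as + length bs) ≡⟨ sym (+-suc (length as) (length bs)) ⟩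
  length as + suc (length bs) ≡⟨ sym (length-++ as) ⟩
  length (as ++ x ∷ bs)       ∎
  where
  open ≤-Reasoning
  move : ∀ {y} → x ≢ y × y ∈ as ++ x ∷ bs → y ∈ as ++ bs
  move (x≢y , y∈) with ∈-++⁻ as y∈
  ... | inj₁ y∈as            = ∈-++⁺ˡ y∈as
  ... | inj₂ (here refl)     = ⊥-elim (x≢y refl)
  ... | inj₂ (there y∈bs)    = ∈-++⁺ʳ as y∈bs

filter∈sublists : ∀ {A : Set} {P : A → Set} (P? : ∀ x → Dec (P x)) xs → filter P? xs ∈ sublists xs
filter∈sublists P? []       = here refl
filter∈sublists P? (x ∷ xs) with P? x
... | yes _ = ∈-++⁺ʳ (sublists xs) (∈-map⁺ (x ∷_) (filter∈sublists P? xs))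
... | no  _ = ∈-++⁺ˡ (filter∈sublists P? xs)

sublist-⊆ : ∀ {A : Set} (xs : List A) {ys} → ys ∈ sublists xs → All (_∈ xs) ys
sublist-⊆ []       (here refl) = []
sublist-⊆ (x ∷ xs) ys∈ with ∈-++⁻ (sublists xs) ys∈
... | inj₁ ys∈′ = All.map there (sublist-⊆ xs ys∈′)
... | inj₂ ys∈′ with zs , zs∈ , refl ← ∈-map⁻ (x ∷_) ys∈′ =
      here refl ∷ All.map there (sublist-⊆ xs zs∈)

module _ {n : ℕ} where

  _≟ᴵ_ : DecidableEquality (Interval n)
  interval l r _ ≟ᴵ interval l′ r′ _ with l Fin.≟ l′ | r Fin.≟ r′
  ... | yes refl | yes refl = yes refl
  ... | no  l≢l′ | _        = no λ { refl → l≢l′ refl }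
  ... | _        | no  r≢r′ = no λ { refl → r≢r′ refl }

  open import Data.List.Membership.DecPropositional _≟ᴵ_ using (_∈?_)

  apart : ∀ (I J : Interval n) → Disjoint I J → end I < start J ⊎ end J < start I
  apart I J dis with right I Fin.<? left J
  ... | yes p = inj₁ p
  ... | no ¬p = inj₂ (disjoint⇒apart I J dis ¬p)

  -- The insertion step of a sort: `I` lies entirely to the left or to the right of each window of
  -- the chain, so it fits between two of them or at an end.
  insert : ∀ {F G : ℕ → ℕ → Set} {hi lo k} (I : Interval n) →
           (∀ {x y} → F x y → end I < x ⊎ y < start I) →
           (∀ {x y} → F x y → G x y) → G (start I) (end I) →
           lo ≤ start I → end I < hi → Chain F hi lo k → Chain G hi lo (suc k)
  insert I dis F⊆G gI lo≤I I<hi (stop _) = link lo≤I (start≤end I) gI (stop I<hi)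
  insert I dis F⊆G gI lo≤I I<hi (link lo≤x x≤y fxy c) with dis fxy
  ... | inj₁ I<x = link lo≤I (start≤end I) gI
                     (chain-map (λ _ _ _ → F⊆G) (link I<x x≤y fxy c))
  ... | inj₂ y<I = link lo≤x x≤y (F⊆G fxy) (insert I dis F⊆G gI y<I I<hi c)

  Member : List (Interval n) → ℕ → ℕ → Set
  Member S x y = ∃[ I ] I ∈ S × start I ≡ x × end I ≡ y

  independent-chain : ∀ {hi} → n ≤ hi → ∀ S → Independent S → Chain (Member S) hi 0 (length S)
  independent-chain n≤hi []      _         = stop z≤n
  independent-chain n≤hi (I ∷ S) (I# ∷ S!) =
    insert I (λ { (J , J∈ , refl , refl) → apart I J (All.lookup I# J∈) })
      (λ { (J , J∈ , eqs) → J , there J∈ , eqs }) (I , here refl , refl , refl)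
      z≤n (≤-trans (Fin.toℕ<n (right I)) n≤hi) (independent-chain n≤hi S S!)

  α-witness : ∀ 𝕀 → α {n} 𝕀 ≡ 0 ⊎ ∃[ S ] All (_∈ 𝕀) S × Independent S × α 𝕀 ≡ length S
  α-witness 𝕀 = case argmax-sel id 0 (map length (filter independent? (sublists 𝕀))) of λ
    { (inj₁ α≡0) → inj₁ α≡0
    ; (inj₂ α∈)  →
        let S , S∈ , α≡ = ∈-map⁻ length α∈
            S∈′ , S!    = ∈-filter⁻ independent? {xs = sublists 𝕀} S∈
        in inj₂ (S , sublist-⊆ 𝕀 S∈′ , S! , α≡) }

  α-chain : ∀ {hi} → n ≤ hi → ∀ {X} 𝕀 → All (_∈ X) 𝕀 → Chain (Contains X) hi 0 (α 𝕀)
  α-chain {hi} n≤hi {X} 𝕀 𝕀⊆X = case α-witness 𝕀 of λ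
    { (inj₁ α≡0) → subst (Chain (Contains X) hi 0) (sym α≡0) (stop z≤n)
    ; (inj₂ (S , S⊆𝕀 , S! , α≡)) → subst (Chain (Contains X) hi 0) (sym α≡)
        (chain-map (λ { _ _ _ (I , I∈ , refl , refl) →
                        I , All.lookup 𝕀⊆X (All.lookup S⊆𝕀 I∈) , ≤-refl , ≤-refl })
                   (independent-chain n≤hi S S!)) }

  _≺_ : Interval n → Interval n → Set
  I ≺ J = end I < start J

  ≺⇒≢ : ∀ {I J} → I ≺ J → I ≢ J
  ≺⇒≢ {I} I≺I refl = <⇒≱ I≺I (start≤end I)

  chain-intervals : ∀ {X hi lo k} → Chain (Contains X) hi lo k →
    ∃[ c ] length c ≡ k × All (_∈ X) c × All (λ I → lo ≤ start I) c × AllPairs _≺_ c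
  chain-intervals (stop _) = [] , refl , [] , [] , []
  chain-intervals (link lo≤x x≤y (I , I∈ , x≤I , I≤y) ch) =
    let c , len , c⊆ , y<c , c≺ = chain-intervals ch
    in I ∷ c , cong suc len , I∈ ∷ c⊆ ,
       ≤-trans lo≤x x≤I ∷ All.map (λ y< → ≤-trans (≤-trans lo≤x (≤-trans x≤y (n≤1+n _))) y<) y<c ,
       All.map (≤-trans (s≤s I≤y)) y<c ∷ c≺

  comparable : ∀ {c} → AllPairs _≺_ c → ∀ {I J} → I ∈ c → J ∈ c → I ≢ J → Disjoint I J
  comparable (_  ∷ _)  (here refl) (here refl) I≢J = ⊥-elim (I≢J refl)
  comparable (I≺ ∷ _)  {I} {J} (here refl) (there J∈) _ = apart⇒disjoint I J (All.lookup I≺ J∈)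
  comparable (J≺ ∷ _)  {I} {J} (there I∈) (here refl) _ =
    λ x (x∈I , x∈J) → apart⇒disjoint J I (All.lookup J≺ I∈) x (x∈J , x∈I)
  comparable (_  ∷ c≺) (there I∈) (there J∈) I≢J = comparable c≺ I∈ J∈ I≢J

  independent-filter : ∀ {c} → AllPairs _≺_ c → ∀ S → Unique S → All (_∈ c) S → Independent S
  independent-filter c≺ []      _          _           = []
  independent-filter c≺ (I ∷ S) (I∉ ∷ S!) (I∈ ∷ S⊆) =
    All.zipWith (λ (I≢J , J∈) → comparable c≺ I∈ J∈ I≢J) (I∉ , S⊆) ∷ independent-filter c≺ S S! S⊆

  length≤α : ∀ 𝕀 {S} → S ∈ sublists 𝕀 → Independent S → length S ≤ α {n} 𝕀
  length≤α 𝕀 S∈ S! = All.lookup (xs≤max 0 (map length (filter independent? (sublists 𝕀))))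
    (∈-map⁺ length (∈-filter⁺ independent? S∈ S!))

  -- `α` ranges over sublists in stream order, while `c` is ordered from left to right. So `c` is
  -- replaced by the sublist of `𝕀` that consists of its members, which is at least as long by the
  -- pigeonhole principle.
  ≺-length≤α : ∀ 𝕀 → Unique 𝕀 → ∀ {c} → AllPairs _≺_ c → All (_∈ 𝕀) c → length c ≤ α 𝕀
  ≺-length≤α 𝕀 𝕀! {c} c≺ c⊆𝕀 = ≤-trans
    (unique-⊆-length (AllPairs.map ≺⇒≢ c≺)
      (All.tabulate (λ I∈c → ∈-filter⁺ (_∈? c) (All.lookup c⊆𝕀 I∈c) I∈c)))
    (length≤α 𝕀 (filter∈sublists (_∈? c) 𝕀)
      (independent-filter c≺ (filter (_∈? c) 𝕀) (Unique.filter⁺ (_∈? c) 𝕀!) (All.all-filter (_∈? c) 𝕀)))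

  chain≤α : ∀ {X hi lo k} 𝕀 → Unique 𝕀 → All (_∈ 𝕀) X →
            Chain (Contains X) hi lo k → k ≤ α 𝕀
  chain≤α 𝕀 𝕀! X⊆𝕀 ch = let c , len , c⊆X , _ , c≺ = chain-intervals ch in
    subst (_≤ α 𝕀) len (≺-length≤α 𝕀 𝕀! c≺ (All.map (All.lookup X⊆𝕀) c⊆X))

-- Fractions x / (1 + k)

toℚᵘ-/ : ∀ x k → ℚ.toℚᵘ (+ x / suc k) ℚᵘ.≃ mkℚᵘ (+ x) k
toℚᵘ-/ x k = ℚ.toℚᵘ-fromℚᵘ (mkℚᵘ (+ x) k)

fromℕ-* : ∀ x y → fromℕ (x * y) ≡ fromℕ x ℚ.* fromℕ y
fromℕ-* x y = ℚ.toℚᵘ-injective (ℚᵘ.≃-trans (toℚᵘ-/ (x * y) 0) (ℚᵘ.≃-trans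
  (*≡* (cong (ℤ._* + 1) (ℤ.pos-* x y)))
  (ℚᵘ.≃-sym (ℚᵘ.≃-trans (ℚ.toℚᵘ-homo-* (fromℕ x) (fromℕ y))
    (ℚᵘ.*-cong (toℚᵘ-/ x 0) (toℚᵘ-/ y 0))))))

fromℕ-mono : ∀ {x y} → x ≤ y → fromℕ x ℚ.≤ fromℕ y
fromℕ-mono {x} {y} x≤y = ℚ.toℚᵘ-cancel-≤ (ℚᵘ.≤-respˡ-≃ (ℚᵘ.≃-sym (toℚᵘ-/ x 0))
  (ℚᵘ.≤-respʳ-≃ (ℚᵘ.≃-sym (toℚᵘ-/ y 0)) (*≤* (ℤ.*-monoʳ-≤-nonNeg (+ 1) (ℤ.+≤+ x≤y)))))

fromℕ-nonNeg : ∀ x → ℚ.NonNegative (fromℕ x)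
fromℕ-nonNeg x = ℚ.normalize-nonNeg x 1

inv : ℕ → ℚ
inv k = + 1 / suc k

inv-nonNeg : ∀ k → ℚ.NonNegative (inv k)
inv-nonNeg k = ℚ.normalize-nonNeg 1 (suc k)

inv-inverse : ∀ k → inv k ℚ.* fromℕ (suc k) ≡ 1ℚ
inv-inverse k = ℚ.toℚᵘ-injective (ℚᵘ.≃-trans (ℚ.toℚᵘ-homo-* (inv k) (fromℕ (suc k)))
  (ℚᵘ.≃-trans (ℚᵘ.*-cong (toℚᵘ-/ 1 k) (toℚᵘ-/ (suc k) 0))
    (*≡* (cong +_ (lemma k)))))
  where
  lemma : ∀ k → (1 * suc k) * 1 ≡ 1 * (suc k * 1)
  lemma k = trans (*-assoc 1 (suc k) 1) refl

frac : ℕ → ℕ → ℚ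
frac x k = fromℕ x ℚ.* inv k

frac-≤ : ∀ x k y l → x * suc l ≤ y * suc k → frac x k ℚ.≤ frac y l
frac-≤ x k y l x≤y = begin
  fromℕ x ℚ.* inv k
    ≡⟨ expand x k l ⟩
  fromℕ (x * suc l) ℚ.* (inv k ℚ.* inv l)
    ≤⟨ ℚ.*-monoʳ-≤-nonNeg (inv k ℚ.* inv l)
         {{ℚ.nonNeg*nonNeg⇒nonNeg (inv k) {{inv-nonNeg k}} (inv l) {{inv-nonNeg l}}}} (fromℕ-mono x≤y) ⟩
  fromℕ (y * suc k) ℚ.* (inv k ℚ.* inv l)
    ≡⟨ cong (fromℕ (y * suc k) ℚ.*_) (ℚ.*-comm (inv k) (inv l)) ⟩
  fromℕ (y * suc k) ℚ.* (inv l ℚ.* inv k)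
    ≡⟨ sym (expand y l k) ⟩
  fromℕ y ℚ.* inv l ∎
  where
  open ℚ.≤-Reasoning
  expand : ∀ x k l → fromℕ x ℚ.* inv k ≡ fromℕ (x * suc l) ℚ.* (inv k ℚ.* inv l)
  expand x k l = begin-equality
    fromℕ x ℚ.* inv k
      ≡⟨ sym (ℚ.*-identityʳ _) ⟩
    fromℕ x ℚ.* inv k ℚ.* 1ℚ
      ≡⟨ cong (fromℕ x ℚ.* inv k ℚ.*_) (sym (inv-inverse l)) ⟩
    fromℕ x ℚ.* inv k ℚ.* (inv l ℚ.* fromℕ (suc l))
      ≡⟨ ℚ-Solver.solve 4 (λ a b c d → a ℚ-Solver.:* b ℚ-Solver.:* (c ℚ-Solver.:* d)
           ℚ-Solver.:= a ℚ-Solver.:* d ℚ-Solver.:* (b ℚ-Solver.:* c)) refl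
           (fromℕ x) (inv k) (inv l) (fromℕ (suc l)) ⟩
    fromℕ x ℚ.* fromℕ (suc l) ℚ.* (inv k ℚ.* inv l)
      ≡⟨ cong (ℚ._* (inv k ℚ.* inv l)) (sym (fromℕ-* x (suc l))) ⟩
    fromℕ (x * suc l) ℚ.* (inv k ℚ.* inv l) ∎

frac-cancel : ∀ x → frac x 0 ≡ fromℕ x
frac-cancel x = ℚ.*-identityʳ (fromℕ x)

two-thirds : ∀ x y → 2 * x ≤ 3 * y → (+ 2 / 3) ℚ.* fromℕ x ℚ.≤ fromℕ y
two-thirds x y 2x≤3y = begin
  (+ 2 / 3) ℚ.* fromℕ x              ≡⟨ ℚ.*-assoc (+ 1 / 3) (fromℕ 2) (fromℕ x) ⟩
  (+ 1 / 3) ℚ.* (fromℕ 2 ℚ.* fromℕ x) ≡⟨ cong ((+ 1 / 3) ℚ.*_) (sym (fromℕ-* 2 x)) ⟩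
  (+ 1 / 3) ℚ.* fromℕ (2 * x)        ≤⟨ ℚ.*-monoˡ-≤-nonNeg (+ 1 / 3) (fromℕ-mono 2x≤3y) ⟩
  (+ 1 / 3) ℚ.* fromℕ (3 * y)        ≡⟨ cong ((+ 1 / 3) ℚ.*_) (fromℕ-* 3 y) ⟩
  (+ 1 / 3) ℚ.* (fromℕ 3 ℚ.* fromℕ y) ≡⟨ sym (ℚ.*-assoc (+ 1 / 3) (fromℕ 3) (fromℕ y)) ⟩
  1ℚ ℚ.* fromℕ y                     ≡⟨ ℚ.*-identityˡ (fromℕ y) ⟩
  fromℕ y                            ∎
  where open ℚ.≤-Reasoning

inv-< : ∀ {k l} → k < l → inv l ℚ.< inv k
inv-< {k} {l} k<l = ℚ.toℚᵘ-cancel-< (ℚᵘ.<-respˡ-≃ (ℚᵘ.≃-sym (toℚᵘ-/ 1 l))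
  (ℚᵘ.<-respʳ-≃ (ℚᵘ.≃-sym (toℚᵘ-/ 1 k)) (ℚᵘ.*<* (ℤ.+<+ lemma))))
  where
  lemma : 1 * suc k < 1 * suc l
  lemma = *-monoʳ-< 1 (s≤s k<l)

archimedean : ∀ q → 0ℚ ℚ.< q → ∃[ k ] inv k ℚ.< q
archimedean q@(mkℚ (ℤ.-[1+ _ ]) _ _) 0<q = ⊥-elim (ℚ.<-asym 0<q (ℚ.negative⁻¹ q))
archimedean (mkℚ (+ zero) _ _)   (ℚ.*<* (ℤ.+<+ ()))
archimedean (mkℚ (+ suc x) d _) _ = suc d , ℚ.toℚᵘ-cancel-<
  (ℚᵘ.<-respˡ-≃ (ℚᵘ.≃-sym (toℚᵘ-/ 1 (suc d))) (ℚᵘ.*<* (ℤ.+<+ lemma)))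
  where
  lemma : 1 * suc d < suc x * suc (suc d)
  lemma = ≤-trans (≤-reflexive (cong suc (*-identityˡ (suc d)))) (m≤m+n (suc (suc d)) _)

lower<upper : ∀ x {p q} → p <ˡ x → x <ʳ q → p ℚ.< q
lower<upper x {p} {q} p<x x<q with p ℚ.<? q
... | yes p<q = p<q
... | no  p≮q = ⊥-elim (ℝ.disjoint x p<x (q≤p (ℚ.≮⇒≥ p≮q)))
  where
  q≤p : q ℚ.≤ p → x <ʳ p
  q≤p q≤p with q ℚ.<? p
  ... | yes q<p = ℝ.upper-closed x q<p x<q
  ... | no  q≮p = subst (x <ʳ_) (ℚ.≤-antisym q≤p (ℚ.≮⇒≥ q≮p)) x<q

-- Locating ε between consecutive unit fractions

bracket : ∀ ε → 0ℚ <ˡ ε → ε <ʳ ½ → ∃[ k ] inv (2 + k) <ˡ ε × ε <ʳ inv k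
bracket ε 0<ε ε<½ = search (proj₁ bound) 1 (m≤m+n _ 1) ε<½
  where
  bound : ∃[ b ] inv b <ˡ ε
  bound = let q , 0<q , q<ε = ℝ.lower-open ε 0<ε
              b , b<q = archimedean q 0<q
          in b , ℝ.lower-closed ε b<q q<ε
  search : ∀ fuel k → proj₁ bound ≤ fuel + k → ε <ʳ inv k → ∃[ k ] inv (2 + k) <ˡ ε × ε <ʳ inv k
  -- A real cannot be compared with a single rational; locatedness only yields `inv (2 + k)` < ε or
  -- ε < `inv (1 + k)`. Hence the bracket skips one unit fraction.
  search fuel k b≤ ε<k with ℝ.located ε (inv-< {suc k} {2 + k} ≤-refl)
  ... | inj₁ <ε = k , <ε , ε<k
  ... | inj₂ ε< with fuel
  ...   | suc fuel′ = search fuel′ (suc k) (≤-trans b≤ (≤-reflexive (sym (+-suc fuel′ k)))) ε<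
  ...   | zero with m≤n⇒m<n∨m≡n b≤
  ...     | inj₁ b<k = ⊥-elim (ℝ.disjoint ε (ℝ.lower-closed ε (inv-< b<k) (proj₂ bound)) ε<k)
  ...     | inj₂ b≡k = ⊥-elim (ℝ.disjoint ε (subst (λ b → inv b <ˡ ε) b≡k (proj₂ bound)) ε<k)

-- Two factors `q` absorb the square of 1 + `k`, as q(1 + k) ≤ 1; the other three are at most 1.
power-bound : ∀ {q k c s} → 0ℚ ℚ.< q → q ℚ.< inv k → s ≤ suc k * suc k * c →
              (q ℚ.* q ℚ.* q ℚ.* q ℚ.* q) ℚ.* fromℕ s ℚ.≤ fromℕ c
power-bound {q} {k} {c} {s} 0<q q<inv s≤ = begin
  q ℚ.* q ℚ.* q ℚ.* q ℚ.* q ℚ.* fromℕ s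
    ≤⟨ ℚ.*-monoˡ-≤-nonNeg (q ℚ.* q ℚ.* q ℚ.* q ℚ.* q) {{q⁵≥0}} (fromℕ-mono s≤) ⟩
  q ℚ.* q ℚ.* q ℚ.* q ℚ.* q ℚ.* fromℕ (suc k * suc k * c)
    ≡⟨ cong (q ℚ.* q ℚ.* q ℚ.* q ℚ.* q ℚ.*_)
         (trans (fromℕ-* (suc k * suc k) c) (cong (ℚ._* fromℕ c) (fromℕ-* (suc k) (suc k)))) ⟩
  q ℚ.* q ℚ.* q ℚ.* q ℚ.* q ℚ.* (K ℚ.* K ℚ.* fromℕ c)
    ≡⟨ ℚ-Solver.solve 3 (λ q K c → q :* q :* q :* q :* q :* (K :* K :* c) :=
         q :* (q :* (q :* (q :* K :* (q :* K :* c))))) refl q K (fromℕ c) ⟩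
  q ℚ.* (q ℚ.* (q ℚ.* (q ℚ.* K ℚ.* (q ℚ.* K ℚ.* fromℕ c))))
    ≤⟨ shrink q q≥0 q≤1 (shrink q q≥0 q≤1 (shrink q q≥0 q≤1
         (shrink (q ℚ.* K) qK≥0 qK≤1 (shrink (q ℚ.* K) qK≥0 qK≤1 ℚ.≤-refl)))) ⟩
  fromℕ c ∎
  where
  open ℚ.≤-Reasoning
  open ℚ-Solver using (_:*_; _:=_)
  K : ℚ
  K = fromℕ (suc k)
  q≥0 : ℚ.NonNegative q
  q≥0 = ℚ.nonNegative (ℚ.<⇒≤ 0<q)
  q²≥0 : ℚ.NonNegative (q ℚ.* q)
  q²≥0 = ℚ.nonNeg*nonNeg⇒nonNeg q {{q≥0}} q {{q≥0}}
  q³≥0 : ℚ.NonNegative (q ℚ.* q ℚ.* q)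
  q³≥0 = ℚ.nonNeg*nonNeg⇒nonNeg (q ℚ.* q) {{q²≥0}} q {{q≥0}}
  q⁴≥0 : ℚ.NonNegative (q ℚ.* q ℚ.* q ℚ.* q)
  q⁴≥0 = ℚ.nonNeg*nonNeg⇒nonNeg (q ℚ.* q ℚ.* q) {{q³≥0}} q {{q≥0}}
  q⁵≥0 : ℚ.NonNegative (q ℚ.* q ℚ.* q ℚ.* q ℚ.* q)
  q⁵≥0 = ℚ.nonNeg*nonNeg⇒nonNeg (q ℚ.* q ℚ.* q ℚ.* q) {{q⁴≥0}} q {{q≥0}}
  qK≥0 : ℚ.NonNegative (q ℚ.* K)
  qK≥0 = ℚ.nonNeg*nonNeg⇒nonNeg q {{q≥0}} K {{fromℕ-nonNeg (suc k)}}
  qK≤1 : q ℚ.* K ℚ.≤ 1ℚ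
  qK≤1 = ℚ.≤-trans (ℚ.*-monoʳ-≤-nonNeg K {{fromℕ-nonNeg (suc k)}} (ℚ.<⇒≤ q<inv))
    (ℚ.≤-reflexive (inv-inverse k))
  inv≤1 : ∀ k → inv k ℚ.≤ 1ℚ
  inv≤1 zero    = ℚ.≤-refl
  inv≤1 (suc k) = ℚ.<⇒≤ (inv-< {0} {suc k} (s≤s z≤n))
  q≤1 : q ℚ.≤ 1ℚ
  q≤1 = ℚ.≤-trans (ℚ.<⇒≤ q<inv) (inv≤1 k)
  shrink : ∀ r {x} → ℚ.NonNegative r → r ℚ.≤ 1ℚ → x ℚ.≤ fromℕ c → r ℚ.* x ℚ.≤ fromℕ c
  shrink r r≥0 r≤1 x≤c = ℚ.≤-trans (ℚ.*-monoˡ-≤-nonNeg r {{r≥0}} x≤c)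
    (ℚ.≤-trans (ℚ.*-monoʳ-≤-nonNeg (fromℕ c) {{fromℕ-nonNeg c}} r≤1)
      (ℚ.≤-reflexive (ℚ.*-identityˡ (fromℕ c))))

fromℕ-suc : ∀ x → fromℕ (suc x) ≡ fromℕ x ℚ.+ 1ℚ
fromℕ-suc x = ℚ.toℚᵘ-injective (ℚᵘ.≃-trans (toℚᵘ-/ (suc x) 0) (ℚᵘ.≃-trans
  (*≡* (trans (ℤ.*-identityʳ (+ suc x)) (sym (trans (ℤ.*-identityʳ _)
    (trans (cong (ℤ._+ + 1) (ℤ.*-identityʳ (+ x))) (cong +_ (+-comm x 1)))))))
  (ℚᵘ.≃-sym (ℚᵘ.≃-trans (ℚ.toℚᵘ-homo-+ (fromℕ x) 1ℚ)
    (ℚᵘ.+-congˡ (ℚ.toℚᵘ 1ℚ) (toℚᵘ-/ x 0))))))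

1-inv : ∀ k → 1ℚ ℚ.- inv k ≡ frac k k
1-inv k = begin
  1ℚ ℚ.- inv k
    ≡⟨ cong (ℚ._- inv k) (sym (inv-inverse k)) ⟩
  inv k ℚ.* fromℕ (suc k) ℚ.- inv k
    ≡⟨ cong (λ x → inv k ℚ.* x ℚ.- inv k) (fromℕ-suc k) ⟩
  inv k ℚ.* (fromℕ k ℚ.+ 1ℚ) ℚ.- inv k
    ≡⟨ ℚ-Solver.solve 2 (λ i x → i :* (x :+ con 1ℚ) :- i := x :* i) refl (inv k) (fromℕ k) ⟩
  fromℕ k ℚ.* inv k ∎
  where
  open ≡-Reasoning
  open ℚ-Solver using (_:*_; _:+_; _:-_; _:=_; con)

-- From the estimate to the output

module _ {r g Z : ℕ} (accurate : 2 * suc r * ∣ Z - g ∣ ≤ g) where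

  private
    E : ℕ
    E = 2 * suc r

  -- The factor E/(1 + E) exactly compensates the possible overestimate Z ≤ (1 + 1/E) g.
  upper-value : frac (E * Z) E ℚ.≤ fromℕ g
  upper-value = ℚ.≤-trans (frac-≤ (E * Z) E g 0 (begin
    E * Z * 1             ≡⟨ *-identityʳ (E * Z) ⟩
    E * Z                 ≤⟨ *-monoʳ-≤ E (m≤∣m-n∣+n Z g) ⟩
    E * (∣ Z - g ∣ + g)   ≡⟨ *-distribˡ-+ E ∣ Z - g ∣ g ⟩
    E * ∣ Z - g ∣ + E * g ≤⟨ +-monoˡ-≤ (E * g) accurate ⟩
    suc E * g             ≡⟨ *-comm (suc E) g ⟩
    g * suc E             ∎)) (ℚ.≤-reflexive (frac-cancel g))
    where open ≤-Reasoning

  -- From Z ≥ (1 - 1/E) g the output is at least (E - 1)/(E + 1) g = (2r + 1)/(2r + 3) g, which is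
  -- at least r/(r + 1) g. This is where `E` needs the factor 2.
  lower-value : frac (r * g) r ℚ.≤ frac (E * Z) E
  lower-value = frac-≤ (r * g) r (E * Z) E (begin
    r * g * suc E         ≤⟨ m≤m+n _ g ⟩
    r * g * suc E + g     ≡⟨ lemma₁ r g ⟩
    (2 * r + 1) * g * suc r
      ≤⟨ *-monoˡ-≤ (suc r) (+-cancelʳ-≤ g _ _ (begin
        (2 * r + 1) * g + g     ≡⟨ lemma₂ r g ⟩
        E * g                   ≤⟨ *-monoʳ-≤ E (m≤n+∣n-m∣ g Z) ⟩
        E * (Z + ∣ Z - g ∣)     ≡⟨ *-distribˡ-+ E Z ∣ Z - g ∣ ⟩
        E * Z + E * ∣ Z - g ∣   ≤⟨ +-monoʳ-≤ (E * Z) accurate ⟩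
        E * Z + g               ∎)) ⟩
    E * Z * suc r ∎)
    where
    open ≤-Reasoning
    lemma₁ : ∀ r g → r * g * (1 + 2 * (1 + r)) + g ≡ (2 * r + 1) * g * (1 + r)
    lemma₁ = solve-∀
    lemma₂ : ∀ r g → (2 * r + 1) * g + g ≡ 2 * (1 + r) * g
    lemma₂ = solve-∀

  approximates : ∀ {a} ε → inv r <ˡ ε → g ≤ a → a ≤ 2 * g →
                 Approximates ε a (frac (E * Z) E)
  approximates {a} ε r<ε g≤a a≤2g = below-value , ℚ.≤-trans upper-value (fromℕ-mono g≤a)
    where
    open ℚ.≤-Reasoning
    frac≥0 : ℚ.NonNegative (frac r r)
    frac≥0 = ℚ.nonNeg*nonNeg⇒nonNeg (fromℕ r) {{fromℕ-nonNeg r}} (inv r) {{inv-nonNeg r}}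
    below-value : ∀ q → ε <ʳ q → ½ ℚ.* (1ℚ ℚ.- q) ℚ.* fromℕ a ℚ.≤ frac (E * Z) E
    below-value q ε<q = begin
      ½ ℚ.* (1ℚ ℚ.- q) ℚ.* fromℕ a
        ≤⟨ ℚ.*-monoʳ-≤-nonNeg (fromℕ a) {{fromℕ-nonNeg a}} (ℚ.*-monoˡ-≤-nonNeg ½
             (ℚ.+-monoʳ-≤ 1ℚ (ℚ.neg-antimono-≤ r≤q))) ⟩
      ½ ℚ.* (1ℚ ℚ.- inv r) ℚ.* fromℕ a
        ≡⟨ trans (cong (λ x → ½ ℚ.* x ℚ.* fromℕ a) (1-inv r)) (commute (frac r r) (fromℕ a)) ⟩
      frac r r ℚ.* ½ ℚ.* fromℕ a
        ≤⟨ ℚ.*-monoˡ-≤-nonNeg (frac r r ℚ.* ½)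
             {{ℚ.nonNeg*nonNeg⇒nonNeg (frac r r) {{frac≥0}} ½}} (fromℕ-mono a≤2g) ⟩
      frac r r ℚ.* ½ ℚ.* fromℕ (2 * g)
        ≡⟨ cong (frac r r ℚ.* ½ ℚ.*_) (fromℕ-* 2 g) ⟩
      frac r r ℚ.* ½ ℚ.* (fromℕ 2 ℚ.* fromℕ g)
        ≡⟨ regroup (fromℕ r) (inv r) (fromℕ g) ⟩
      fromℕ r ℚ.* fromℕ g ℚ.* inv r
        ≡⟨ cong (ℚ._* inv r) (sym (fromℕ-* r g)) ⟩
      frac (r * g) r
        ≤⟨ lower-value ⟩
      frac (E * Z) E ∎
      where
      open ℚ-Solver using (_:*_; _:=_; con)
      r≤q : inv r ℚ.≤ q
      r≤q = ℚ.≮⇒≥ (λ q<r → ℝ.disjoint ε (ℝ.lower-closed ε q<r r<ε) ε<q)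
      commute : ∀ x y → ½ ℚ.* x ℚ.* y ≡ x ℚ.* ½ ℚ.* y
      commute x y = cong (ℚ._* y) (ℚ.*-comm ½ x)
      regroup : ∀ x i y → x ℚ.* i ℚ.* ½ ℚ.* (fromℕ 2 ℚ.* y) ≡ x ℚ.* y ℚ.* i
      regroup = ℚ-Solver.solve 3 (λ x i y → x :* i :* con ½ :* (con (fromℕ 2) :* y) := x :* y :* i) refl

-- Events decided by the first draw

vectors-unique : ∀ {A : Set} {xs : List A} → Unique xs → ∀ k → Unique (vectors xs k)
vectors-unique xs! zero    = [] ∷ []
vectors-unique xs! (suc k) = Unique.cartesianProductWith⁺ _∷_ Vec.∷-injective xs! (vectors-unique xs! k)

length-filter≡∑ : ∀ {A : Set} {P : A → Set} (P? : ∀ x → Dec (P x)) xs →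
                  length (filter P? xs) ≡ ∑ xs (λ x → ⟦ does (P? x) ⟧)
length-filter≡∑ P? []       = refl
length-filter≡∑ P? (x ∷ xs) with P? x
... | yes _ = cong suc (length-filter≡∑ P? xs)
... | no  _ = length-filter≡∑ P? xs

∑-allFin : ∀ {A : Set} (xs : List A) f → ∑ (allFin (length xs)) (f ∘ lookup xs) ≡ ∑ xs f
∑-allFin xs f = trans (sym (∑-map (lookup xs) (allFin (length xs)) f))
  (cong (λ ys → ∑ ys f) (trans (map-tabulate id (lookup xs)) (tabulate-lookup xs)))

Pr-first : ∀ {c k} {Good : Fin c → Set} {E : Vec (Fin c) (suc k) → Set} →
           (good? : ∀ i → Dec (Good i)) → (∀ i ω → Good i → E (i ∷ ω)) →
           2 * c ≤ 3 * ∑ (allFin c) (λ i → ⟦ does (good? i) ⟧) →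
           Pr[ E ]≥ (+ 2 / 3)
Pr-first {c} {k} {Good} {E} good? good⇒E 2c≤ =
  cartesianProductWith _∷_ goods tails ,
  Unique.cartesianProductWith⁺ _∷_ Vec.∷-injective
    (Unique.filter⁺ good? (Unique.allFin⁺ c)) (vectors-unique (Unique.allFin⁺ c) k) ,
  favourable goods (All.all-filter good? (allFin c)) ,
  two-thirds (c ^ suc k) (length (cartesianProductWith _∷_ goods tails)) (begin
    2 * (c * c ^ k)
      ≡⟨ sym (*-assoc 2 c (c ^ k)) ⟩
    2 * c * c ^ k
      ≤⟨ *-monoˡ-≤ (c ^ k) 2c≤ ⟩
    3 * ∑ (allFin c) (λ i → ⟦ does (good? i) ⟧) * c ^ k
      ≡⟨ *-assoc 3 (∑ (allFin c) (λ i → ⟦ does (good? i) ⟧)) (c ^ k) ⟩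
    3 * (∑ (allFin c) (λ i → ⟦ does (good? i) ⟧) * c ^ k)
      ≡⟨ cong (3 *_) (sym (trans (length-cartesianProductWith _∷_ goods tails) (cong₂ _*_
           (length-filter≡∑ good? (allFin c))
           (trans (length-vectors (allFin c) k) (cong (_^ k) (length-tabulate {n = c} id)))))) ⟩
    3 * length (cartesianProductWith _∷_ goods tails) ∎)
  where
  open ≤-Reasoning
  goods : List (Fin c)
  goods = filter good? (allFin c)
  tails : List (Vec (Fin c) k)
  tails = vectors (allFin c) k
  favourable : ∀ is → All Good is → All E (cartesianProductWith _∷_ is tails)
  favourable []       []       = []
  favourable (i ∷ is) (g ∷ gs) =
    All.++⁺ (All.map⁺ (All.tabulate (λ {ω} _ → good⇒E i ω g))) (favourable is gs)

-- The algorithm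

module Algorithm (n h M : ℕ) (out : ℕ → ℚ) where

  open Streaming n h M public

  𝕊 : List (Seed (h * 2) h)
  𝕊 = seeds (h * 2) h

  length-𝕊>0 : 0 < length 𝕊
  length-𝕊>0 = subst (0 <_) (sym (trans (length-vectors (rows (h * 2)) h)
    (cong (_^ h) (length-vectors bits (suc (h * 2))))))
    (m^n>0 (2 ^ suc (h * 2)) {{m^n≢0 2 (suc (h * 2))}} h)

  algorithm : StreamingAlgorithm (2 + n) units
  algorithm = record
    { coins   = length 𝕊
    ; coins≢0 = >-nonZero length-𝕊>0
    -- All randomness used is drawn here and kept in memory as the seed; the later draws are
    -- ignored.
    ; start   = λ c → encode code-state (state (lookup 𝕊 c) [])
    ; process = λ _ I μ → let s , Ls = decode code-state μ in
                  encode code-state (s , advances 0 s I Ls)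
    ; output  = λ _ μ → let s , Ls = decode code-state μ in out (answer 0 s Ls)
    }

  resume-state : ∀ 𝕀 cs s X → resume algorithm 𝕀 cs (encode code-state (state s X)) ≡
                              out (answer 0 s (levels 0 (suc h) s (𝕀 ʳ++ X)))
  resume-state []      (c ∷ []) s X =
    cong (λ (s , Ls) → out (answer 0 s Ls)) (decode-encode code-state (state s X))
  resume-state (I ∷ 𝕀) (c ∷ cs) s X = trans
    (cong (resume algorithm 𝕀 cs)
      (trans (cong (λ (s , Ls) → encode code-state (s , advances 0 s I Ls))
                   (decode-encode code-state (state s X)))
             (cong (λ Ls → encode code-state (s , Ls)) (advances-levels 0 (suc h) s I X))))
    (resume-state 𝕀 cs s (I ∷ X))

module Correctness (n h k : ℕ) where

  -- Estimates are to have relative error 1 / E.  At the last level that is needed,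
  -- a table is expected to have at most P entries, and 12 P overflow it.
  E P : ℕ
  E = 2 * suc (2 + k)
  P = 16 * (E * E) * (suc h * suc h)

  open Algorithm n h (12 * P) (λ Z → frac (E * Z) E) public

  module _ (n≤2^h : 2 + n ≤ 2 ^ h) (ε : ℝ) (k<ε : inv (2 + k) <ˡ ε)
           (𝕀 : List (Interval (2 + n))) (𝕀! : Unique 𝕀) where

    X : List (Interval (2 + n))
    X = reverse 𝕀

    d : Node h → ℕ
    d = jump h 0 (label X h 0)

    open Moments {h} {h} d (jump≤1 X h 0) using (N; g; ∑-weighted)
    open Accuracy {h} {h} d (jump≤1 X h 0) (size X) E P

    g≡gain : g ≡ gain h 0 (label X h 0)
    g≡gain = ∑-jump h 0 (label X h 0)

    α≤2g : α 𝕀 ≤ 2 * g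
    α≤2g = ≤-trans (chain≤2gain X h 0 (α-chain n≤2^h 𝕀 (All.tabulate Any.reverse⁺)))
                   (≤-reflexive (cong (2 *_) (sym g≡gain)))

    g≤α : g ≤ α 𝕀
    g≤α = ≤-trans (≤-reflexive g≡gain)
                  (chain≤α 𝕀 𝕀! (All.tabulate Any.reverse⁻) (gain-chain X h 0))

    -- Chosen so that the union bound 2 E² `excess j` / g on the probability of a fault is at most
    -- 1/4 once `excess j * K` is at most `g`.
    K : ℕ
    K = 8 * (E * E)

    -- Ensures that the level chosen by `∃-level` is at most `h`, so that the seed has enough rows
    -- and the sketch has a table for it.
    g<top : g < excess (suc h) * K
    g<top = begin-strict
      g                         ≤⟨ ≤-trans (≤-reflexive g≡gain) (gain≤2^ X h 0) ⟩
      2 ^ h                     ≡⟨ 2^≡1+excess h ⟩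
      suc (excess h)            <⟨ ≤-trans (m≤m+n (2 + excess h) (3 * excess h))
                                           (≤-reflexive (double (excess h))) ⟩
      2 * excess (suc h)        ≤⟨ *-monoˡ-≤ (excess (suc h)) 2≤K ⟩
      K * excess (suc h)        ≡⟨ *-comm K (excess (suc h)) ⟩
      excess (suc h) * K        ∎
      where
      open ≤-Reasoning
      2≤K : 2 ≤ K
      2≤K = s≤s (s≤s z≤n)
      double : ∀ x → 2 + x + 3 * x ≡ 2 * (1 + 2 * x)
      double = solve-∀

    -- The mean size is at most (1 + h)² g / 2ʲ, and g ≤ 2 · 2ʲ · K = 16 E² · 2ʲ by the choice of
    -- the level. This is the origin of `P`.
    ∑-size : ∀ {j} → j ≤ h → g ≤ excess (suc j) * K →
             2 ^ j * ∑ 𝕊 (size X j) ≤ N * (2 ^ j * P)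
    ∑-size {j} j≤h g≤ = begin
      2 ^ j * ∑ 𝕊 (size X j)
        ≤⟨ *-monoʳ-≤ (2 ^ j) (∑-mono 𝕊 (size≤ X j)) ⟩
      2 ^ j * ∑ 𝕊 (λ s → ∑ (nodes h) (λ u → ⟦ kept j s u ⟧ * below (active X h 0) u))
        ≡⟨ ∑-weighted j≤h (below (active X h 0)) ⟩
      N * ∑ (nodes h) (below (active X h 0))
        ≤⟨ *-monoʳ-≤ N (≤-trans (∑-below h (active X h 0)) (*-monoʳ-≤ (suc h) (∑-active X h 0))) ⟩
      N * (suc h * (suc h * gain h 0 (label X h 0)))
        ≤⟨ *-monoʳ-≤ N (*-monoʳ-≤ (suc h) (*-monoʳ-≤ (suc h) gain≤)) ⟩
      N * (suc h * (suc h * (2 * 2 ^ j * K)))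
        ≡⟨ cong (N *_) (regroup (suc h) (2 ^ j) (E * E)) ⟩
      N * (2 ^ j * P) ∎
      where
      open ≤-Reasoning
      excess≤ : excess (suc j) ≤ 2 * 2 ^ j
      excess≤ = ≤-trans (n≤1+n _) (≤-reflexive (sym (2^≡1+excess (suc j))))
      gain≤ : gain h 0 (label X h 0) ≤ 2 * 2 ^ j * K
      gain≤ = ≤-trans (≤-reflexive (sym g≡gain)) (≤-trans g≤ (*-monoˡ-≤ K excess≤))
      regroup : ∀ c b e → c * (c * (2 * b * (8 * e))) ≡ b * (16 * e * (c * c))
      regroup = solve-∀

    correct : Pr[ (λ ω → Approximates ε (α 𝕀) (run algorithm 𝕀 ω)) ]≥ (+ 2 / 3)
    correct =
      let j , j≤h , lo , hi = ∃-level K g h g<top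
      in Pr-first (λ i → accurate? j (lookup 𝕊 i))
           (λ i ω (fits , flawless) →
             let i′ , i′≤j , eq = answer-levels 0 (suc h) (lookup 𝕊 i) X z≤n (s≤s j≤h) fits
             in subst (Approximates ε (α 𝕀))
                  (sym (trans (resume-state 𝕀 ω (lookup 𝕊 i) []) (cong (λ Z → frac (E * Z) E) eq)))
                  (approximates {2 + k} {g} {estimate i′ (lookup 𝕊 i) d}
                    (faults≡0⇒accurate i′≤j flawless) ε k<ε g≤α α≤2g))
           (≤-trans (mostly-accurate j≤h lo (∑-size j≤h hi))
             (≤-reflexive (cong (3 *_)
               (sym (∑-allFin 𝕊 (λ s → ⟦ does (accurate? j s) ⟧))))))

-- The space bound

n<2^1+⌊log₂n⌋ : ∀ n → n < 2 ^ suc ⌊log₂ n ⌋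
n<2^1+⌊log₂n⌋ n = ≰⇒> λ 2^≤n →
  <-irrefl refl (≤-trans (≤-reflexive (sym (⌊log₂[2^n]⌋≡n (suc ⌊log₂ n ⌋)))) (⌊log₂⌋-mono-≤ 2^≤n))

1≤⌊log₂n⌋ : ∀ {n} → 2 ≤ n → 1 ≤ ⌊log₂ n ⌋
1≤⌊log₂n⌋ 2≤n = ≤-trans (≤-reflexive (sym (⌊log₂[2^n]⌋≡n 1))) (⌊log₂⌋-mono-≤ 2≤n)

-- Of the 39, 36 pay for the table entries, since 12(3 + 2h) ≤ 36(1 + h), and 3 for the seed and the
-- overflow flags. `slack` is the exact difference, which turns the bound into a polynomial
-- identity.
units-bound : ∀ n h P → 1 ≤ P → Streaming.units n h (12 * P) ≤ 39 * (suc h * suc h * P)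
units-bound n h (suc P) _ = ≤-trans (m≤m+n _ slack) (≤-reflexive (lemma h P))
  where
  slack : ℕ
  slack = 2 + 16 * h + 13 * (h * h) + P * (3 + 18 * h + 15 * (h * h))
  lemma : ∀ h P → h * ((1 + h * 2) * 1) + (1 + h) * (1 + 12 * (1 + P) * (1 + (h * 2 * 1 + 2)))
                  + (2 + 16 * h + 13 * (h * h) + P * (3 + 18 * h + 15 * (h * h)))
                  ≡ 39 * ((1 + h) * (1 + h) * (1 + P))
  lemma = solve-∀

-- The constants are variables, since numerals would be unfolded into sums.
regroup≤ : ∀ a b d t {C} m L {p c} → a * b * (d * d) * (t * t * t * t * t * t) ≡ C →
           p ≤ t * m → c ≤ t * L → 1 ≤ L →
           a * (c * c * (b * (d * p * (d * p)) * (c * c))) ≤ m * m * (C * L ^ 6)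
regroup≤ a b d t m L {p} {c} refl p≤ c≤ 1≤L = begin
  a * (c * c * (b * (d * p * (d * p)) * (c * c)))
    ≤⟨ *-monoʳ-≤ a (*-mono-≤ c²≤ (*-mono-≤ (*-monoʳ-≤ b (*-mono-≤ dp≤ dp≤)) c²≤)) ⟩
  a * (t * L * (t * L) * (b * (d * (t * m) * (d * (t * m))) * (t * L * (t * L))))
    ≡⟨ lemma a b d t m L ⟩
  m * m * (C * (L * L * L * L))
    ≤⟨ *-monoʳ-≤ (m * m) (*-monoʳ-≤ C (begin
         L * L * L * L  ≡⟨ power L ⟩
         L ^ 4          ≤⟨ ^-monoʳ-≤ L {{>-nonZero 1≤L}} (m≤m+n 4 2) ⟩
         L ^ 6          ∎)) ⟩
  m * m * (C * L ^ 6) ∎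
  where
  open ≤-Reasoning
  C : ℕ
  C = a * b * (d * d) * (t * t * t * t * t * t)
  c²≤ : c * c ≤ t * L * (t * L)
  c²≤ = *-mono-≤ c≤ c≤
  dp≤ : d * p ≤ d * (t * m)
  dp≤ = *-monoʳ-≤ d p≤
  lemma : ∀ a b d t m L → a * (t * L * (t * L) * (b * (d * (t * m) * (d * (t * m))) * (t * L * (t * L))))
                          ≡ m * m * (a * b * (d * d) * (t * t * t * t * t * t) * (L * L * L * L))
  lemma = solve-∀
  power : ∀ L → L * L * L * L ≡ L * (L * (L * (L * 1)))
  power = solve-∀

-- 39 stems from `units-bound`, 16 from `P`, and 2 * 2 from the square of `E`. Two of the factors 3
-- come from 3 + k ≤ 3(1 + k), squared, and four from 2 + L ≤ 3L, to the fourth power.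
space-constant : ℕ
space-constant = 39 * 16 * (2 * 2) * (3 * 3 * 3 * 3 * 3 * 3)

module _ {C : ℕ} (constant : space-constant ≡ C) where

  units≤ : ∀ n L k → 1 ≤ L →
           Streaming.units n (suc L) (12 * Correctness.P n (suc L) k) ≤ suc k * suc k * (C * L ^ 6)
  units≤ n L k 1≤L = ≤-trans (units-bound n (suc L) (Correctness.P n (suc L) k) (s≤s z≤n))
    (regroup≤ 39 16 2 3 {C} (suc k) L {suc (2 + k)} {suc (suc L)} constant p≤ c≤ 1≤L)
    where
    p≤ : 3 + k ≤ 3 * suc k
    p≤ = ≤-trans (m≤m+n (3 + k) (2 * k)) (≤-reflexive (triple k))
      where
      triple : ∀ k → 3 + k + 2 * k ≡ 3 * (1 + k)
      triple = solve-∀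
    c≤ : 2 + L ≤ 3 * L
    c≤ = ≤-trans (≤-reflexive (+-comm 2 L)) (+-monoʳ-≤ L (*-monoʳ-≤ 2 1≤L))

  space-bound : ∀ n L k → 1 ≤ L → ∀ ε → ε <ʳ inv k → ∀ q → 0ℚ ℚ.< q → q <ˡ ε →
                (q ℚ.* q ℚ.* q ℚ.* q ℚ.* q) ℚ.*
                fromℕ (Streaming.units n (suc L) (12 * Correctness.P n (suc L) k)) ℚ.≤ fromℕ (C * L ^ 6)
  space-bound n L k 1≤L ε ε<k q 0<q q<ε =
    power-bound {q} {k} {C * L ^ 6} 0<q (lower<upper ε q<ε ε<k) (units≤ n L k 1≤L)

  solution : ∀ n L → 1 ≤ L → 2 + n ≤ 2 ^ suc L → ∀ ε → 0ℚ <ˡ ε → ε <ʳ ½ →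
    ∃[ s ] (∀ q → 0ℚ ℚ.< q → q <ˡ ε →
             (q ℚ.* q ℚ.* q ℚ.* q ℚ.* q) ℚ.* fromℕ s ℚ.≤ fromℕ (C * L ^ 6)) ×
    (Σ[ A ∈ StreamingAlgorithm (2 + n) s ]
    (∀ (𝕀 : List (Interval (2 + n))) → Unique 𝕀 →
    Pr[ (λ ω → Approximates ε (α 𝕀) (run A 𝕀 ω)) ]≥ (+ 2 / 3)))
  solution n L 1≤L n≤2^ ε 0<ε ε<½ =
    let k , k<ε , ε<k = bracket ε 0<ε ε<½
    in Streaming.units n (suc L) (12 * Correctness.P n (suc L) k) , space-bound n L k 1≤L ε ε<k ,
       Correctness.algorithm n (suc L) k , Correctness.correct n (suc L) k n≤2^ ε k<ε

theorem12 : ∃[ C ] (∀ (n : ℕ) → 2 ≤ n → (ε : ℝ) → 0ℚ <ˡ ε → ε <ʳ ½ →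
    ∃[ s ] SpaceBound C n ε s ×
    (Σ[ A ∈ StreamingAlgorithm n s ]
    (∀ (𝕀 : List (Interval n)) → Unique 𝕀 →
    Pr[ (λ ω → Approximates ε (α 𝕀) (run A 𝕀 ω)) ]≥ (+ 2 / 3))))
theorem12 = space-constant , main refl
  where
  main : ∀ {C} → space-constant ≡ C →
    ∀ (n : ℕ) → 2 ≤ n → (ε : ℝ) → 0ℚ <ˡ ε → ε <ʳ ½ →
    ∃[ s ] SpaceBound C n ε s ×
    (Σ[ A ∈ StreamingAlgorithm n s ]
    (∀ (𝕀 : List (Interval n)) → Unique 𝕀 →
    Pr[ (λ ω → Approximates ε (α 𝕀) (run A 𝕀 ω)) ]≥ (+ 2 / 3)))
  main constant n@(suc (suc n′)) 2≤n@(s≤s (s≤s _)) =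
    solution constant n′ ⌊log₂ n ⌋ (1≤⌊log₂n⌋ 2≤n) (<⇒≤ (n<2^1+⌊log₂n⌋ n))
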